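{- Let $k \geq 2$ be a natural number and let $G$ be a finite graph of average degree at least $6k$ and girth $g$. Then, for some odd number $r \geq 3$, either $G$ contains cycles of all even lengths in the interval $[r, r + (g-2)k]$, or $G$ contains cycles of all odd lengths in the interval $[r, r+(g-2)k]$.
   Context: The average degree of a graph $G$ is $2|E(G)|/|V(G)|$. The girth of $G$ is the length of a shortest cycle in $G$. -}

module Defs where

open import Data.Nat using (ℕ; zero; suc; _+_; _*_; _∸_; _≤_; _<_)
open import Data.Nat.Divisibility using (_∣_)
open import Data.Fin using (Fin; zero; suc; inject₁; fromℕ; _<?_)
open import Data.List using (List; map; allFin)
open import Data.Nat.ListAction using (sum)
open import Data.Bool using (Bool; true; false; if_then_else_; _∧_)
open import Data.Product using (Σ; _×_)
open import Relation.Binary.PropositionalEquality using (_≡_)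
open import Relation.Nullary using (¬_)
open import Relation.Nullary.Decidable using (⌊_⌋)
open import Function.Definitions using (Injective)

record Graph : Set where
  field
    n      : ℕ
    adj    : Fin n → Fin n → Bool
    sym    : ∀ i j → adj i j ≡ adj j i
    irrefl : ∀ i → adj i i ≡ false
open Graph public

Adj : (G : Graph) → Fin (n G) → Fin (n G) → Set
Adj G i j = adj G i j ≡ true

edgeCount : Graph → ℕ
edgeCount G =
  sum (map (λ i → sum (map (λ j → if ⌊ i <? j ⌋ ∧ adj G i j then 1 else 0)
                           (allFin (n G))))
           (allFin (n G)))

-- Average degree 2|E|/|V| is at least d  (stated without division).
AvgDegreeAtLeast : Graph → ℕ → Set
AvgDegreeAtLeast G d = d * n G ≤ 2 * edgeCount G

HasCycle : (G : Graph) → ℕ → Set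
HasCycle G zero = Data.Empty.⊥
  where import Data.Empty
HasCycle G (suc m) =
  3 ≤ suc m ×
  Σ (Fin (suc m) → Fin (n G)) λ f →
    Injective _≡_ _≡_ f ×
    ((i : Fin m) → Adj G (f (inject₁ i)) (f (suc i))) ×
    Adj G (f (fromℕ m)) (f zero)

Girth : Graph → ℕ → Set
Girth G g = HasCycle G g × (∀ ℓ → ℓ < g → ¬ HasCycle G ℓ)

Even : ℕ → Set
Even ℓ = 2 ∣ ℓ

Odd : ℕ → Set
Odd ℓ = ¬ (2 ∣ ℓ)

{-# OPTIONS --safe #-}
module Submission where

-- Verstraëte's argument.  In a breadth-first forest every edge joins vertices of equal or
-- consecutive levels, so the edges split into three classes (equal levels; levels 2j, 2j+1;
-- levels 2j+1, 2j+2), one of which contains a third of them.  That class has a subgraph of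
-- minimum degree above k.  In it, the first vertex of a longest path has all its neighbours
-- on the path, at mutual distances at least g − 2, which gives a cycle C of length at least
-- (g − 2)k + 2 with a chord.  Let i be the lowest level met by C and h + 1 the least height
-- at which the vertices of C on level i have a common ancestor.  Colour those lying below
-- one particular ancestor at height h.  A cycle with a chord contains two-coloured paths of
-- every length ℓ < |C| unless the colouring has period 2 along C, and such a path with both
-- ends on level i closes up through the forest to a cycle of length ℓ + 2(h + 1).  In the
-- first class all ends are on level i and odd ℓ exclude period 2; in the other two classes
-- even ℓ keep both ends on the same level, and period 2 would make the colouring constant
-- on level i.

open import Defs hiding (sym)
open import Data.Nat.Properties
open import Algebra.Properties.CommutativeMonoid.Sum +-0-commutativeMonoid using (sum; sum-cong-≗; ∑-distrib-+; ∑-comm)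
open import Data.Bool using (Bool; true; false; if_then_else_; _∧_; not)
import Data.Bool.Properties as Bool
open import Data.Empty using (⊥; ⊥-elim)
open import Data.Fin using (Fin; zero; suc; toℕ; fromℕ<)
import Data.Fin as Fin
import Data.Fin.Properties as Fin
import Data.List as List hiding (sum)
import Data.List.Properties as List
open import Data.Nat using (ℕ; zero; suc; _+_; _*_; _∸_; _≤_; _<_; z≤n; s≤s; _%_; _/_; ⌊_/2⌋; >-nonZero)
open import Data.Nat.Divisibility using (_∣_; divides; ∣⇒≤; ∣-trans; ∣m+n∣m⇒∣n; ∣m∣n⇒∣m+n; m∣m*n)
open import Data.Nat.DivMod using (m≡m%n+[m/n]*n; m%n<n; m<n⇒m%n≡m; [m+n]%n≡m%n)
open import Data.Nat.GCD using (gcd; gcd[m,n]∣m; gcd[m,n]∣n; gcd[m,n]≢0; gcd-GCD; module Bézout)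
open import Data.Nat.Induction using (<-wellFounded)
import Data.Nat.ListAction as List
open import Data.Nat.Tactic.RingSolver using (solve-∀)
open import Data.Product using (Σ; ∃; ∃₂; _×_; _,_; proj₁; proj₂)
open import Data.Sum using (_⊎_; inj₁; inj₂; [_,_]′; map₂)
open import Data.Unit using (⊤; tt)
open import Function using (_∘_; id)
open import Induction.WellFounded using (Acc; acc)
open import Relation.Binary.PropositionalEquality using (_≡_; _≢_; refl; sym; trans; cong; cong₂; subst; subst₂; module ≡-Reasoning)
open import Relation.Nullary using (¬_; ¬?; Dec; yes; no)
open import Relation.Nullary.Decidable using (⌊_⌋; _×-dec_; _⊎-dec_; _→-dec_)

-- Paths

-- `ℓ` counts edges. Only the values of `at` up to `ℓ` matter, which spares concatenation any index
-- casts; `P` records where the vertices lie, so that disjointness of paths reduces to disjointness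
-- of predicates.
record Path {X : Set} (_~_ : X → X → Set) (P : X → Set) (x y : X) (ℓ : ℕ) : Set where
  field
    at       : ℕ → X
    source   : at 0 ≡ x
    target   : at ℓ ≡ y
    distinct : ∀ {i j} → i ≤ ℓ → j ≤ ℓ → at i ≡ at j → i ≡ j
    linked   : ∀ {i} → i < ℓ → at i ~ at (suc i)
    inside   : ∀ {i} → i ≤ ℓ → P (at i)

open Path

glue : {X : Set} → ℕ → (ℕ → X) → (ℕ → X) → ℕ → X
glue a       f g zero    = f 0
glue zero    f g (suc z) = g z
glue (suc a) f g (suc z) = glue a (f ∘ suc) g z

glue-left : {X : Set} (a : ℕ) (f g : ℕ → X) {z : ℕ} → z ≤ a → glue a f g z ≡ f z
glue-left a       f g z≤n       = refl
glue-left (suc a) f g (s≤s z≤a) = glue-left a (f ∘ suc) g z≤a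

glue-right : {X : Set} (a : ℕ) (f g : ℕ → X) (z : ℕ) → glue a f g (suc (a + z)) ≡ g z
glue-right zero    f g z = refl
glue-right (suc a) f g z = glue-right a (f ∘ suc) g z

data Position (a : ℕ) : ℕ → Set where
  before : ∀ {z} → z ≤ a → Position a z
  after  : ∀ z → Position a (suc (a + z))

position : ∀ a z → Position a z
position a       zero    = before z≤n
position zero    (suc z) = after z
position (suc a) (suc z) with position a z
... | before z≤a = before (s≤s z≤a)
... | after w    = after w

module _ {X : Set} {_~_ : X → X → Set} where

  trivial : ∀ {P : X → Set} {x} → P x → Path _~_ P x x 0
  trivial {x = x} Px = record
    { at = λ _ → x ; source = refl ; target = refl
    ; distinct = λ { z≤n z≤n _ → refl } ; linked = λ () ; inside = λ _ → Px }

  weaken : ∀ {P Q : X → Set} {x y ℓ} → (∀ {z} → P z → Q z) → Path _~_ P x y ℓ → Path _~_ Q x y ℓ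
  weaken P⊆Q p = record
    { at = at p ; source = source p ; target = target p
    ; distinct = distinct p ; linked = linked p ; inside = P⊆Q ∘ inside p }

  source-inside : ∀ {P : X → Set} {x y ℓ} → Path _~_ P x y ℓ → P x
  source-inside {P} p = subst P (source p) (inside p z≤n)

  target-inside : ∀ {P : X → Set} {x y ℓ} → Path _~_ P x y ℓ → P y
  target-inside {P} p = subst P (target p) (inside p ≤-refl)

  reverse : ∀ {P : X → Set} {x y ℓ} → (∀ {u v} → u ~ v → v ~ u) →
            Path _~_ P x y ℓ → Path _~_ P y x ℓ
  reverse {ℓ = ℓ} ~-sym p = record
    { at       = λ z → at p (ℓ ∸ z)
    ; source   = target p
    ; target   = trans (cong (at p) (n∸n≡0 ℓ)) (source p)
    ; distinct = λ {i} {j} i≤ℓ j≤ℓ eq →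
        ∸-cancelˡ-≡ i≤ℓ j≤ℓ (distinct p (m∸n≤m ℓ i) (m∸n≤m ℓ j) eq)
    ; linked   = λ {i} i<ℓ → ~-sym (subst (λ z → at p (ℓ ∸ suc i) ~ at p z)
        (sym (+-∸-assoc 1 i<ℓ)) (linked p (∸-monoʳ-< (s≤s (z≤n {i})) i<ℓ)))
    ; inside   = λ {i} _ → inside p (m∸n≤m ℓ i) }

  -- Vertices of different pieces are distinct because `P` and `Q` exclude each other; the
  -- connecting edge accounts for the `suc` in the length.
  join : ∀ {P Q R : X → Set} {x y z w a b} →
         Path _~_ P x y a → y ~ z → Path _~_ Q z w b →
         (∀ {v} → P v → Q v → ⊥) → (∀ {v} → P v → R v) → (∀ {v} → Q v → R v) →
         Path _~_ R x w (suc (a + b))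
  join {P} {Q} {R} {a = a} {b} p y~z q apart P⊆R Q⊆R = record
    { at       = h
    ; source   = source p
    ; target   = trans (glue-right a (at p) (at q) b) (target q)
    ; distinct = λ {i} {j} → dist (position a i) (position a j)
    ; linked   = λ {i} → link (position a i)
    ; inside   = λ {i} → ins (position a i) }
    where
    h = glue a (at p) (at q)
    left : ∀ {z} → z ≤ a → h z ≡ at p z
    left = glue-left a (at p) (at q)
    right : ∀ z → h (suc (a + z)) ≡ at q z
    right = glue-right a (at p) (at q)
    bound : ∀ {z} → suc (a + z) ≤ suc (a + b) → z ≤ b
    bound (s≤s le) = +-cancelˡ-≤ a _ _ le
    ins : ∀ {i} → Position a i → i ≤ suc (a + b) → R (h i)
    ins (before i≤a) _  = subst R (sym (left i≤a)) (P⊆R (inside p i≤a))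
    ins (after z)    le = subst R (sym (right z)) (Q⊆R (inside q (bound le)))
    dist : ∀ {i j} → Position a i → Position a j →
           i ≤ suc (a + b) → j ≤ suc (a + b) → h i ≡ h j → i ≡ j
    dist (before i≤a) (before j≤a) _ _ eq =
      distinct p i≤a j≤a (trans (sym (left i≤a)) (trans eq (left j≤a)))
    dist (before i≤a) (after z) _ le eq = ⊥-elim (apart (inside p i≤a)
      (subst Q (sym (trans (sym (left i≤a)) (trans eq (right z)))) (inside q (bound le))))
    dist (after z) (before j≤a) le _ eq = ⊥-elim (apart (inside p j≤a)
      (subst Q (sym (trans (sym (left j≤a)) (trans (sym eq) (right z)))) (inside q (bound le))))
    dist (after z) (after w) le le′ eq = cong (λ u → suc (a + u))
      (distinct q (bound le) (bound le′) (trans (sym (right z)) (trans eq (right w))))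
    link : ∀ {i} → Position a i → i < suc (a + b) → h i ~ h (suc i)
    link {i} (before i≤a) _ with m≤n⇒m<n∨m≡n i≤a
    ... | inj₁ i<a  = subst₂ _~_ (sym (left i≤a)) (sym (left i<a)) (linked p i<a)
    ... | inj₂ refl = subst₂ _~_ (sym (trans (left i≤a) (target p)))
      (sym (trans (trans (cong (h ∘ suc) (sym (+-identityʳ a))) (right 0)) (source q))) y~z
    link (after z) le = subst₂ _~_ (sym (right z))
      (sym (trans (cong (h ∘ suc) (sym (+-suc a z))) (right (suc z))))
      (linked q (bound (subst (_≤ suc (a + b)) (cong suc (sym (+-suc a z))) le)))

embed : ∀ {X Y : Set} {_~_ : X → X → Set} {_≈_ : Y → Y → Set} {P : X → Set} {Q : Y → Set} {x y ℓ} →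
        (f : X → Y) → (∀ {i j} → P i → P j → f i ≡ f j → i ≡ j) →
        (∀ {i j} → i ~ j → f i ≈ f j) → (∀ {i} → P i → Q (f i)) →
        Path _~_ P x y ℓ → Path _≈_ Q (f x) (f y) ℓ
embed f inj hom P⊆Q p = record
  { at       = f ∘ at p
  ; source   = cong f (source p)
  ; target   = cong f (target p)
  ; distinct = λ i≤ j≤ eq → distinct p i≤ j≤ (inj (inside p i≤) (inside p j≤) eq)
  ; linked   = hom ∘ linked p
  ; inside   = P⊆Q ∘ inside p }

-- Periodic colourings and cycles with a chord

infix 4 _≈_[mod_]

record _≈_[mod_] (x y d : ℕ) : Set where
  constructor congruent
  field
    u v    : ℕ
    shifts : x + u * d ≡ y + v * d

module _ {d : ℕ} where

  ≡⇒≈ : ∀ {x y} → x ≡ y → x ≈ y [mod d ]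
  ≡⇒≈ refl = congruent 0 0 refl

  ≈-sym : ∀ {x y} → x ≈ y [mod d ] → y ≈ x [mod d ]
  ≈-sym (congruent u v eq) = congruent v u (sym eq)

  +-≈ : ∀ {x y z w} → x ≈ y [mod d ] → z ≈ w [mod d ] → x + z ≈ y + w [mod d ]
  +-≈ {x} {y} {z} {w} (congruent u v p) (congruent u′ v′ q) = congruent (u + u′) (v + v′) (
    trans (shuffle x z u u′ d) (trans (cong₂ _+_ p q) (sym (shuffle y w v v′ d))))
    where
    shuffle : ∀ a b s t e → a + b + (s + t) * e ≡ (a + s * e) + (b + t * e)
    shuffle = solve-∀

  ≈-cancel : ∀ {x y z w} → x + z ≈ y + w [mod d ] → z ≈ w [mod d ] → x ≈ y [mod d ]
  ≈-cancel {x} {y} {z} {w} (congruent u v p) (congruent u′ v′ q) = congruent (u + v′) (v + u′) (+-cancelʳ-≡ (z + w) _ _ (begin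
    x + (u + v′) * d + (z + w)       ≡⟨ shuffle x z w u v′ d ⟩
    (x + z + u * d) + (w + v′ * d)   ≡⟨ cong₂ _+_ p (sym q) ⟩
    (y + w + v * d) + (z + u′ * d)   ≡⟨ sym (shuffle y w z v u′ d) ⟩
    y + (v + u′) * d + (w + z)       ≡⟨ cong (y + (v + u′) * d +_) (+-comm w z) ⟩
    y + (v + u′) * d + (z + w)       ∎))
    where
    open ≡-Reasoning
    shuffle : ∀ a b c s t e → a + (s + t) * e + (b + c) ≡ (a + b + s * e) + (c + t * e)
    shuffle = solve-∀

  -- Add the two congruences and cancel the common `y`.
  ≈-trans : ∀ {x y z} → x ≈ y [mod d ] → y ≈ z [mod d ] → x ≈ z [mod d ]
  ≈-trans {x} {y} {z} p q = ≈-cancel {z = y} {w = y}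
    (≈-trans-+ (+-≈ p q)) (≡⇒≈ refl)
    where
    ≈-trans-+ : x + y ≈ y + z [mod d ] → x + y ≈ z + y [mod d ]
    ≈-trans-+ (congruent u v e) = congruent u v (trans e (cong (_+ v * d) (+-comm y z)))

  ∣⇒≈0 : ∀ {m} → d ∣ m → m ≈ 0 [mod d ]
  ∣⇒≈0 (divides q eq) = congruent 0 q (trans (+-identityʳ _) eq)

  *-≈0 : ∀ x → x * d ≈ 0 [mod d ]
  *-≈0 x = congruent 0 x (+-identityʳ _)

  ≈-drop : ∀ {x y} → y ≈ 0 [mod d ] → x + y ≈ x [mod d ]
  ≈-drop {x} e = ≈-trans (+-≈ (≡⇒≈ refl) e) (≡⇒≈ (+-identityʳ x))

residue : ∀ d s x → ∃ λ t → t < suc d × s + t ≈ x [mod suc d ]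
-- Modulo `suc d`, the product `s * d` stands for minus `s`.
residue d s x = (x + s * d) % suc d , m%n<n (x + s * d) (suc d) ,
  ≈-trans (+-≈ (≡⇒≈ refl) (≈-sym (congruent 0 ((x + s * d) / suc d)
    (trans (+-identityʳ _) (m≡m%n+[m/n]*n (x + s * d) (suc d))))))
  (≈-trans (≡⇒≈ (collect s x d)) (≈-drop (*-≈0 s)))
  where
  collect : ∀ a b e → a + (b + a * e) ≡ b + a * suc e
  collect = solve-∀

Period : (ℕ → Bool) → ℕ → Set
Period c d = ∀ x → c (x + d) ≡ c x

period-* : ∀ {c d} → Period c d → ∀ u x → c (x + u * d) ≡ c x
period-* {c}     per zero    x = cong c (+-identityʳ x)
period-* {c} {d} per (suc u) x =
  trans (cong c (trans (cong (x +_) (+-comm d (u * d))) (sym (+-assoc x (u * d) d))))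
        (trans (per (x + u * d)) (period-* per u x))

period-≈ : ∀ {c d} → Period c d → ∀ {x y} → x ≈ y [mod d ] → c x ≡ c y
period-≈ {c} per {x} {y} (congruent u v eq) =
  trans (sym (period-* per u x)) (trans (cong c eq) (period-* per v y))

-- By Bézout the gcd is a difference of multiples of `a` and `b`; adding the subtracted multiple
-- first keeps every argument a natural number.
period-gcd : ∀ {c a b} → Period c a → Period c b → Period c (gcd a b)
period-gcd {c} {a} {b} pa pb z with Bézout.identity (gcd-GCD a b)
... | Bézout.+- x y eq = begin
  c (z + gcd a b)           ≡⟨ sym (period-* pb y (z + gcd a b)) ⟩
  c (z + gcd a b + y * b)   ≡⟨ cong c (trans (+-assoc z _ _) (cong (z +_) eq)) ⟩
  c (z + x * a)             ≡⟨ period-* pa x z ⟩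
  c z                       ∎
  where open ≡-Reasoning
... | Bézout.-+ x y eq = begin
  c (z + gcd a b)           ≡⟨ sym (period-* pa x (z + gcd a b)) ⟩
  c (z + gcd a b + x * a)   ≡⟨ cong c (trans (+-assoc z _ _) (cong (z +_) eq)) ⟩
  c (z + y * b)             ≡⟨ period-* pb y z ⟩
  c z                       ∎
  where open ≡-Reasoning

-- Used with `A` a bichromatic path, which ends the search, and `Q` the colour equalities that its
-- absence forces.
either-all : ∀ {A : Set} {Q : ℕ → Set} m → (∀ j → j < m → A ⊎ Q j) → A ⊎ (∀ j → j < m → Q j)
either-all zero    f = inj₂ λ _ ()
either-all (suc m) f with f 0 (s≤s z≤n) | either-all m (λ j j<m → f (suc j) (s≤s j<m))
... | inj₁ a | _      = inj₁ a
... | inj₂ _ | inj₁ a = inj₁ a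
... | inj₂ q | inj₂ g = inj₂ λ { zero _ → q ; (suc j) (s≤s j<m) → g j j<m }

-- Makes room for `d` consecutive crossing positions starting at `p + q ∸ n`, all below `q`.
overlap-bound : ∀ p q n d → p + d ≤ n → d ≤ q → (p + q ∸ n) + d ≤ q
overlap-bound p q n d p+d≤n d≤q with ≤-total (p + q) n
... | inj₁ p+q≤n = subst (λ z → z + d ≤ q) (sym (m≤n⇒m∸n≡0 p+q≤n)) d≤q
... | inj₂ n≤p+q = +-cancelʳ-≤ n _ _ (begin
  (p + q ∸ n) + d + n   ≡⟨ swap (p + q ∸ n) d n ⟩
  (p + q ∸ n) + n + d   ≡⟨ cong (_+ d) (m∸n+n≡m n≤p+q) ⟩
  p + q + d             ≡⟨ move p q d ⟩
  q + (p + d)           ≤⟨ +-monoʳ-≤ q p+d≤n ⟩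
  q + n                 ∎)
  where
  open ≤-Reasoning
  swap : ∀ a b e → a + b + e ≡ a + e + b
  swap = solve-∀
  move : ∀ a b e → a + b + e ≡ b + (a + e)
  move = solve-∀

private
  regroup₁ : ∀ a e f → suc (a + e + f) ≡ f + suc e + a
  regroup₁ = solve-∀
  regroup₂ : ∀ a e g → a + e + (g + 1) ≡ a + (g + suc e)
  regroup₂ = solve-∀
  swap-suc : ∀ a e → a + suc e ≡ e + (a + 1)
  swap-suc = solve-∀
  add-one : ∀ a e → a + e + 1 ≡ a + 1 * suc e
  add-one = solve-∀
  slide : ∀ a e → a + suc e ≡ (a + 1) + e
  slide = solve-∀
  mirror₁ : ∀ a e g → a + suc (e + suc a * g) ≡ e + suc a * suc g
  mirror₁ = solve-∀
  mirror₂ : ∀ a e g → (a + 2) + (e + suc a * g) ≡ (e + 1) + suc a * suc g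
  mirror₂ = solve-∀
  regroup₃ : ∀ a e f → suc (a + e + f) ≡ a + (f + suc e)
  regroup₃ = solve-∀
  regroup₄ : ∀ a e g → a + e + suc g ≡ a + (g + suc e)
  regroup₄ = solve-∀
  regroup₅ : ∀ a e g → suc a + (e + g) ≡ e + a + suc g
  regroup₅ = solve-∀
  regroup₆ : ∀ a g h → a + (h + suc g) ≡ a + g + suc h
  regroup₆ = solve-∀
  regroup₇ : ∀ a g h → a + suc (g + h) ≡ g + (a + suc h)
  regroup₇ = solve-∀

-- The cycle is `0, 1, ..., b` and the chord joins `0` to `r`; the bounds on `r` give both arcs at
-- least two edges. Colourings are defined on all naturals with period `N`, so that positions can be
-- treated modulo `N` and its divisors.
module Chord (_~_ : ℕ → ℕ → Set) (~-sym : ∀ {i j} → i ~ j → j ~ i)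
  (b r : ℕ) (2≤r : 2 ≤ r) (r<b : r < b)
  (step : ∀ {i} → i < b → i ~ suc i) (close : b ~ 0) (chord : 0 ~ r) where

  N : ℕ
  N = suc b

  Vertices : ℕ → Set
  Vertices z = z < N

  segment : ∀ {s i e} → s + i ≡ e → e < N → Path _~_ (λ z → s ≤ z × z ≤ e) s e i
  segment {s} {i} {e} refl (s≤s e≤b) = record
    { at       = s +_
    ; source   = +-identityʳ s
    ; target   = refl
    ; distinct = λ {x} {y} _ _ eq → +-cancelˡ-≡ s x y eq
    ; linked   = λ {x} x<i → subst ((s + x) ~_) (sym (+-suc s x))
        (step (≤-trans (≤-trans (≤-reflexive (sym (+-suc s x))) (+-monoʳ-≤ s x<i)) e≤b))
    ; inside   = λ {x} x≤i → m≤m+n s x , +-monoʳ-≤ s x≤i }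

  segment⁻ : ∀ {s i e} → s + i ≡ e → e < N → Path _~_ (λ z → s ≤ z × z ≤ e) e s i
  segment⁻ eq e<n = reverse ~-sym (segment eq e<n)

  resize : ∀ {P : ℕ → Set} {x y ℓ m} → ℓ ≡ m → Path _~_ P x y ℓ → Path _~_ P x y m
  resize refl p = p

  -- Walks from 0 backwards along the cycle, ending at w = N − i, or at 0 when i = 0.
  backward : ∀ {w i} → w + i ≡ N → i < N →
    ∃ λ v → v ≈ w [mod N ] × Path _~_ (λ z → z < N × (z ≡ 0 ⊎ N ≤ z + i)) 0 v i
  backward {w} {zero} eq _ = 0 , congruent 1 0 (trans (+-identityʳ N) (sym eq)) ,
    trivial (s≤s z≤n , inj₁ refl)
  backward {w} {suc i} eq i<n = w , ≡⇒≈ refl ,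
    join (trivial {P = _≡ 0} refl) (~-sym close) (segment⁻ w+i≡b ≤-refl)
      (λ { refl (w≤0 , _) → <⇒≱ i<n (≤-reflexive (trans (sym eq) (cong (_+ suc i) (n≤0⇒n≡0 w≤0)))) })
      (λ { refl → s≤s z≤n , inj₁ refl })
      (λ { {z} (w≤z , z≤b) → s≤s z≤b , inj₂ (≤-trans (≤-reflexive (sym eq)) (+-monoˡ-≤ (suc i) w≤z)) })
    where
    w+i≡b : w + i ≡ b
    w+i≡b = suc-injective (trans (sym (+-suc w i)) eq)

  r<N : r < N
  r<N = m<n⇒m<1+n r<b

  module _ (c : ℕ → Bool) (c-period : Period c N) (ℓ : ℕ) (0<ℓ : 0 < ℓ) (ℓ<n : ℓ < N) where

    Bichromatic : Set
    Bichromatic = ∃₂ λ x y → Path _~_ Vertices x y ℓ × c x ≡ true × c y ≡ false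

    -- Ends of different colours give a bichromatic path, after reversal if necessary. Equal colours
    -- are passed on to congruent positions, which hides any wrapping around the cycle.
    compare : ∀ {x y x′ y′} → x ≈ x′ [mod N ] → y ≈ y′ [mod N ] →
              Path _~_ Vertices x y ℓ → Bichromatic ⊎ c x′ ≡ c y′
    compare {x} {y} x≈ y≈ p with c x in ex | c y in ey
    ... | true  | false = inj₁ (x , y , p , ex , ey)
    ... | false | true  = inj₁ (y , x , reverse ~-sym p , ey , ex)
    ... | true  | true  = inj₂ (trans (sym (period-≈ c-period x≈))
                                 (trans (trans ex (sym ey)) (period-≈ c-period y≈)))
    ... | false | false = inj₂ (trans (sym (period-≈ c-period x≈))
                                 (trans (trans ex (sym ey)) (period-≈ c-period y≈)))

    along : ∀ x → x < N → Bichromatic ⊎ c (x + ℓ) ≡ c x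
    along x x<n with x + ℓ <? N
    ... | yes x+ℓ<n = compare (≡⇒≈ refl) (≡⇒≈ refl)
      (weaken (λ { (_ , z≤) → ≤-<-trans z≤ x+ℓ<n }) (segment⁻ refl x+ℓ<n))
    -- The arc runs past `b` and ends at `w = x + ℓ ∸ N`; as `ℓ < N`, this lies before `x`, so the
    -- two pieces are disjoint.
    ... | no x+ℓ≮n = compare w≈x+ℓ (≡⇒≈ refl) (reverse ~-sym (resize len
      (join (segment x+t≡b ≤-refl) close (segment {0} refl w<n)
        (λ { (x≤z , _) (_ , z≤w) → <⇒≱ w<x (≤-trans x≤z z≤w) })
        (λ { (_ , z≤b) → s≤s z≤b }) (λ { (_ , z≤w) → ≤-<-trans z≤w w<n }))))
      where
      w t : ℕ
      w = x + ℓ ∸ N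
      t = b ∸ x
      n≤x+ℓ : N ≤ x + ℓ
      n≤x+ℓ = ≮⇒≥ x+ℓ≮n
      w+n≡ : w + N ≡ x + ℓ
      w+n≡ = m∸n+n≡m n≤x+ℓ
      x+t≡b : x + t ≡ b
      x+t≡b = m+[n∸m]≡n (≤-pred x<n)
      w<x : w < x
      w<x = +-cancelʳ-< N w x (≤-<-trans (≤-reflexive w+n≡) (+-monoʳ-< x ℓ<n))
      w<n : w < N
      w<n = <-trans w<x x<n
      w≈x+ℓ : w ≈ x + ℓ [mod N ]
      w≈x+ℓ = congruent 1 0 (trans (cong (w +_) (+-identityʳ N)) (trans w+n≡ (sym (+-identityʳ _))))
      len : suc (t + w) ≡ ℓ
      len = +-cancelˡ-≡ x _ _ (trans (trans (regroup x t w) (cong (λ z → w + suc z) x+t≡b)) w+n≡)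
        where
        regroup : ∀ a e f → a + suc (e + f) ≡ f + suc (a + e)
        regroup = solve-∀

    ℓ-split : ∀ {j} → j < ℓ → j + suc (ℓ ∸ suc j) ≡ ℓ
    ℓ-split {j} j<ℓ = trans (+-suc j _) (m+[n∸m]≡n j<ℓ)

    -- The four ways to cross the chord: the two arcs leave 0 and r in these directions.
    up-up : ∀ {i j} → j + suc i ≡ ℓ → j < r → r + i < N → Bichromatic ⊎ c j ≡ c (r + i)
    up-up {i} {j} eq j<r r+i<n = compare (≡⇒≈ refl) (≡⇒≈ refl) (resize (trans (sym (+-suc j i)) eq)
      (join (segment⁻ {0} refl (<-trans j<r r<N)) chord (segment refl r+i<n)
        (λ { (_ , z≤j) (r≤z , _) → <⇒≱ j<r (≤-trans r≤z z≤j) })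
        (λ { (_ , z≤j) → <-trans (≤-<-trans z≤j j<r) r<N })
        (λ { (_ , z≤) → ≤-<-trans z≤ r+i<n })))

    down-down : ∀ {i j s w} → j + suc i ≡ ℓ → s + j ≡ r → w + i ≡ N → j < r → r + i < N →
                Bichromatic ⊎ c w ≡ c s
    down-down {i} {j} {s} {w} eq s+j≡r w+i≡n j<r r+i<n
      with backward w+i≡n (≤-<-trans (m≤n+m i r) r+i<n)
    ... | v , v≈w , p = compare v≈w (≡⇒≈ refl) (reverse ~-sym
      (resize (trans (sym (+-suc j i)) eq)
      (join (segment s+j≡r r<N) (~-sym chord) p
        (λ { (s≤z , z≤r) (_ , inj₁ refl) → <⇒≱ j<r (≤-reflexive (trans (sym s+j≡r) (cong (_+ j) (n≤0⇒n≡0 s≤z))))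
           ; (s≤z , z≤r) (_ , inj₂ n≤z+i) → <⇒≱ r+i<n (≤-trans n≤z+i (+-monoˡ-≤ i z≤r)) })
        (λ { (_ , z≤r) → ≤-<-trans z≤r r<N })
        proj₁)))

    down-up : ∀ {i j w} → j + suc i ≡ ℓ → w + j ≡ N → r + i + j < N → Bichromatic ⊎ c w ≡ c (r + i)
    down-up {i} {j} {w} eq w+j≡n r+i+j<n with backward w+j≡n (≤-<-trans (m≤n+m j (r + i)) r+i+j<n)
    ... | v , v≈w , p = compare v≈w (≡⇒≈ refl) (resize (trans (sym (+-suc j i)) eq)
      (join (reverse ~-sym p) chord (segment refl r+i<n)
        (λ { (_ , inj₁ refl) (r≤0 , _) → <⇒≱ 2≤r (≤-trans r≤0 z≤n)
           ; (_ , inj₂ n≤z+j) (_ , z≤) → <⇒≱ r+i+j<n (≤-trans n≤z+j (+-monoˡ-≤ j z≤)) })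
        proj₁
        (λ { (_ , z≤) → ≤-<-trans z≤ r+i<n })))
      where
      r+i<n : r + i < N
      r+i<n = ≤-<-trans (m≤m+n (r + i) j) r+i+j<n

    up-down : ∀ {i j s} → j + suc i ≡ ℓ → s + i ≡ r → i + j < r → Bichromatic ⊎ c j ≡ c s
    up-down {i} {j} {s} eq s+i≡r i+j<r = compare (≡⇒≈ refl) (≡⇒≈ refl) (resize (trans (sym (+-suc j i)) eq)
      (join (segment⁻ {0} refl (<-trans j<r r<N)) chord (segment⁻ s+i≡r r<N)
        (λ { (_ , z≤j) (s≤z , _) → <⇒≱ i+j<r (≤-trans (≤-reflexive (sym s+i≡r))
               (≤-trans (+-monoˡ-≤ i (≤-trans s≤z z≤j)) (≤-reflexive (+-comm j i)))) })
        (λ { (_ , z≤j) → <-trans (≤-<-trans z≤j j<r) r<N })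
        (λ { (_ , z≤r) → ≤-<-trans z≤r r<N })))
      where
      j<r : j < r
      j<r = ≤-<-trans (m≤n+m j i) i+j<r

    -- The current period `suc d` divides both `ℓ` and `N`, so both vanish modulo it and a crossing
    -- matters only through the residues of its ends.
    module _ (d : ℕ) (per : Period c (suc d)) (d∣ℓ : suc d ∣ ℓ) (d∣n : suc d ∣ N) where

      ℓ≈0 : ℓ ≈ 0 [mod suc d ]
      ℓ≈0 = ∣⇒≈0 d∣ℓ

      n≈0 : N ≈ 0 [mod suc d ]
      n≈0 = ∣⇒≈0 d∣n

      d≤ℓ : suc d ≤ ℓ
      d≤ℓ = ∣⇒≤ {{>-nonZero 0<ℓ}} d∣ℓ

      -- The difference of `N` and `ℓ` is a positive multiple of `suc d`.
      ℓ+d≤n : ℓ + suc d ≤ N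
      ℓ+d≤n = ≤-trans (+-monoʳ-≤ ℓ (∣⇒≤ {{>-nonZero (m<n⇒0<n∸m ℓ<n)}}
        (∣m+n∣m⇒∣n (subst (suc d ∣_) (sym (m+[n∸m]≡n (<⇒≤ ℓ<n))) d∣n) d∣ℓ)))
        (≤-reflexive (m+[n∸m]≡n (<⇒≤ ℓ<n)))

      -- A window of `suc d` consecutive crossings meets every residue class, whatever its start
      -- `s`.
      residues : (R : ℕ → Set) → (s : ℕ) → (∀ t → t < suc d → Bichromatic ⊎ R (s + t)) →
                 Bichromatic ⊎ (∀ x → ∃ λ j → j ≈ x [mod suc d ] × R j)
      residues R s f = map₂ (λ g x → let (t , t<d , s+t≈x) = residue d s x in s + t , s+t≈x , g t t<d)
                         (either-all (suc d) f)

      -- Two reflections compose to a translation by 2.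
      reflections : suc d ≤ r → r + suc d ≤ N → Bichromatic ⊎ Period c 2
      reflections d≤r r+d≤n = [ inj₁ , (λ f → map₂ (combine f) (residues R₂ j₀ second)) ]′ (residues R₁ j₀ first)
        where
        j₀ : ℕ
        -- The least `j` for which the `i` with `j + suc i ≡ ℓ` satisfies `r + i < N`, so that the
        -- second arc does not wrap.
        j₀ = ℓ + r ∸ N
        R₁ R₂ : ℕ → Set
        R₁ j = ∃ λ i → j + suc i ≡ ℓ × c j ≡ c (r + i)
        R₂ j = ∃ λ i → ∃₂ λ s w → j + suc i ≡ ℓ × s + j ≡ r × w + i ≡ N × c w ≡ c s
        j<r : ∀ {t} → t < suc d → j₀ + t < r
        j<r t<d = <-≤-trans (+-monoʳ-< j₀ t<d) (overlap-bound ℓ r N (suc d) ℓ+d≤n d≤r)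
        j<ℓ : ∀ {t} → t < suc d → j₀ + t < ℓ
        j<ℓ t<d = <-≤-trans (+-monoʳ-< j₀ t<d)
          (subst (λ z → z ∸ N + suc d ≤ ℓ) (+-comm r ℓ) (overlap-bound r ℓ N (suc d) r+d≤n d≤ℓ))
        r+i<n : ∀ {t i} → j₀ + t + suc i ≡ ℓ → r + i < N
        r+i<n {t} {i} eq = +-cancelʳ-< (j₀ + t) _ _ (≤-trans
          (≤-reflexive (trans (regroup₁ r i (j₀ + t)) (cong (_+ r) eq)))
          (≤-trans (m≤n+m∸n (ℓ + r) N) (+-monoʳ-≤ N (m≤m+n j₀ t))))
        first : ∀ t → t < suc d → Bichromatic ⊎ R₁ (j₀ + t)
        first t t<d = map₂ (λ e → _ , split , e) (up-up split (j<r t<d) (r+i<n split))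
          where
          split : j₀ + t + suc (ℓ ∸ suc (j₀ + t)) ≡ ℓ
          split = ℓ-split (j<ℓ t<d)
        second : ∀ t → t < suc d → Bichromatic ⊎ R₂ (j₀ + t)
        second t t<d = map₂ (λ e → i , s , w , split , s+j , w+i , e)
            (down-down {i} {j₀ + t} {s} {w} split s+j w+i (j<r t<d) (r+i<n split))
          where
          i s w : ℕ
          i = ℓ ∸ suc (j₀ + t)
          s = r ∸ (j₀ + t)
          w = N ∸ i
          split : j₀ + t + suc i ≡ ℓ
          split = ℓ-split (j<ℓ t<d)
          s+j : s + (j₀ + t) ≡ r
          s+j = m∸n+n≡m (<⇒≤ (j<r t<d))
          w+i : w + i ≡ N
          w+i = m∸n+n≡m (≤-trans (m≤n+m i r) (<⇒≤ (r+i<n split)))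
        -- An `up-up` crossing has ends `j` and `r + i` with `j + i + 1 = ℓ ≈ 0`, so the colouring
        -- is invariant under sending `x` to `r - 1 - x`.
        reflect₁ : ∀ x y → x + suc y ≈ r [mod suc d ] → (∃ λ j → j ≈ x [mod suc d ] × R₁ j) → c x ≡ c y
        reflect₁ x y x+y≈ (j , j≈x , i , j+i≡ , eq) =
          trans (sym (period-≈ per j≈x)) (trans eq (period-≈ per r+i≈y))
          where
          r+i≈y : r + i ≈ y [mod suc d ]
          r+i≈y = ≈-cancel (≈-trans (≡⇒≈ (trans (regroup₂ r i j) (cong (r +_) j+i≡)))
                   (≈-trans (≈-drop ℓ≈0) (≈-trans (≈-sym x+y≈) (≡⇒≈ (swap-suc x y))))) (+-≈ j≈x (≡⇒≈ {x = 1} refl))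
        -- A `down-down` crossing has ends congruent to minus `i` and `r - j`, whose sum is `r + 1`
        -- modulo the period: the reflection sends `x` to `r + 1 - x`. Here `x + d` stands for
        -- `x - 1`.
        reflect₂ : ∀ x y → x + y ≈ r + 1 [mod suc d ] → (∃ λ j → j ≈ x + d [mod suc d ] × R₂ j) → c x ≡ c y
        reflect₂ x y x+y≈ (j , j≈ , i , s , w , j+i≡ , s+j≡ , w+i≡ , eq) =
          trans (sym (period-≈ per w≈x)) (trans eq (period-≈ per s≈y))
          where
          j+1≈x : j + 1 ≈ x [mod suc d ]
          j+1≈x = ≈-trans (+-≈ j≈ (≡⇒≈ {x = 1} refl)) (≈-trans (≡⇒≈ (add-one x d)) (≈-drop (*-≈0 1)))
          w≈x : w ≈ x [mod suc d ]
          w≈x = ≈-cancel {z = i} {w = i} (≈-trans (≡⇒≈ w+i≡) (≈-trans n≈0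
            (≈-trans (≈-sym ℓ≈0) (≈-trans (≡⇒≈ (trans (sym j+i≡) (slide j i))) (+-≈ j+1≈x (≡⇒≈ refl)))))) (≡⇒≈ refl)
          s≈y : s ≈ y [mod suc d ]
          s≈y = ≈-cancel {z = j + 1} {w = x} (≈-trans (≡⇒≈ (trans (sym (+-assoc s j 1)) (cong (_+ 1) s+j≡)))
            (≈-trans (≈-sym x+y≈) (≡⇒≈ (+-comm x y)))) j+1≈x
        combine : (∀ x → ∃ λ j → j ≈ x [mod suc d ] × R₁ j) → (∀ x → ∃ λ j → j ≈ x [mod suc d ] × R₂ j) → Period c 2
        combine f g x = sym (trans
          (reflect₁ x (mirror x) (≈-trans (≡⇒≈ (mirror₁ x r d)) (≈-drop (*-≈0 (suc x)))) (f x))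
          (sym (reflect₂ (x + 2) (mirror x) (≈-trans (≡⇒≈ (mirror₂ x r d)) (≈-drop (*-≈0 (suc x)))) (g (x + 2 + d)))))
          where
          mirror : ℕ → ℕ
          -- This represents `r - 1 - x`, the common image of `x` under the first reflection and of
          -- `x + 2` under the second.
          mirror x = r + suc x * d

      -- Going down `t` from `0` and up `i` from `r` joins minus `t` to `r + i ≈ r - 1 - t`, a
      -- translation by `r - 1`. The bound `r ≤ d` keeps the arcs disjoint for every `t` needed.
      short-chord : ∀ {r′} → r ≡ suc r′ → r ≤ d → Bichromatic ⊎ Period c r′
      short-chord {r′} r≡ r≤d = map₂ (λ f x → shift x (f (x * d))) (residues R 0 crossing)
        where
        R : ℕ → Set
        R t = ∃₂ λ i w → t + suc i ≡ ℓ × w + t ≡ N × c w ≡ c (r + i)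
        crossing : ∀ t → t < suc d → Bichromatic ⊎ R t
        crossing t t<d = map₂ (λ e → i , w , split , w+t , e) (down-up {i} {t} {w} split w+t short)
          where
          i w : ℕ
          i = ℓ ∸ suc t
          w = N ∸ t
          t<ℓ : t < ℓ
          t<ℓ = <-≤-trans t<d d≤ℓ
          split : t + suc i ≡ ℓ
          split = ℓ-split t<ℓ
          w+t : w + t ≡ N
          w+t = m∸n+n≡m (<⇒≤ (<-trans t<ℓ ℓ<n))
          short : r + i + t < N
          short = ≤-trans (≤-reflexive (trans (regroup₃ r i t) (cong (r +_) split)))
            (≤-trans (+-monoˡ-≤ ℓ (m≤n⇒m≤1+n r≤d)) (≤-trans (≤-reflexive (+-comm (suc d) ℓ)) ℓ+d≤n))
        shift : ∀ x → (∃ λ t → t ≈ x * d [mod suc d ] × R t) → c (x + r′) ≡ c x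
        shift x (t , t≈ , i , w , t+i≡ , w+t≡ , eq) =
          trans (sym (period-≈ per r+i≈)) (trans (sym eq) (period-≈ per w≈x))
          where
          x+t≈0 : x + t ≈ 0 [mod suc d ]
          x+t≈0 = ≈-trans (+-≈ (≡⇒≈ refl) t≈) (≈-trans (≡⇒≈ (sym (*-suc x d))) (*-≈0 x))
          w≈x : w ≈ x [mod suc d ]
          w≈x = ≈-cancel {z = t} {w = t} (≈-trans (≡⇒≈ w+t≡) (≈-trans n≈0 (≈-sym x+t≈0))) (≡⇒≈ refl)
          r+i≈ : r + i ≈ x + r′ [mod suc d ]
          r+i≈ = ≈-cancel {z = suc t} {w = suc t} (≈-trans
            (≡⇒≈ (trans (regroup₄ r i t) (cong (r +_) t+i≡))) (≈-trans (≈-drop ℓ≈0)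
            (≈-trans (≈-sym (≈-drop x+t≈0)) (≡⇒≈ (trans (cong (_+ (x + t)) r≡) (regroup₅ r′ x t)))))) (≡⇒≈ refl)

      -- The counterpart for the other arc, which has `suc e` edges: going up `t` from `0` and down
      -- `i` from `r` joins `t` to `r - i ≈ t - e`. The arcs stay apart because `ℓ ≤ r`.
      long-chord : ∀ {e} → r + suc e ≡ N → suc e ≤ d → Bichromatic ⊎ Period c e
      long-chord {e} r+e≡ e<d = map₂ (λ f x → shift x (f (x + e))) (residues R 0 crossing)
        where
        R : ℕ → Set
        R t = ∃₂ λ i s → t + suc i ≡ ℓ × s + i ≡ r × c t ≡ c s
        ℓ≤r : ℓ ≤ r
        ℓ≤r = +-cancelʳ-≤ (suc d) _ _ (≤-trans ℓ+d≤n
          (≤-trans (≤-reflexive (sym r+e≡)) (+-monoʳ-≤ r (m≤n⇒m≤1+n e<d))))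
        crossing : ∀ t → t < suc d → Bichromatic ⊎ R t
        crossing t t<d = map₂ (λ eq → i , s , split , s+i , eq) (up-down {i} {t} {s} split s+i short)
          where
          i s : ℕ
          i = ℓ ∸ suc t
          s = r ∸ i
          split : t + suc i ≡ ℓ
          split = ℓ-split (<-≤-trans t<d d≤ℓ)
          s+i : s + i ≡ r
          s+i = m∸n+n≡m (≤-trans (m∸n≤m ℓ (suc t)) ℓ≤r)
          short : i + t < r
          short = ≤-trans (≤-reflexive (trans (trans (cong suc (+-comm i t)) (sym (+-suc t i))) split)) ℓ≤r
        shift : ∀ x → (∃ λ t → t ≈ x + e [mod suc d ] × R t) → c (x + e) ≡ c x
        shift x (t , t≈ , i , s , t+i≡ , s+i≡ , eq) = trans (sym (period-≈ per t≈)) (trans eq (period-≈ per s≈x))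
          where
          s≈x : s ≈ x [mod suc d ]
          s≈x = ≈-cancel {z = t + suc i} {w = t + suc i} (≈-trans (≡⇒≈ (trans (regroup₆ s i t) (cong (_+ suc t) s+i≡)))
            (≈-trans (+-≈ {x = r} (≡⇒≈ refl) (+-≈ {x = 1} (≡⇒≈ refl) t≈))
            (≈-trans (≡⇒≈ (trans (regroup₇ r x e) (cong (x +_) r+e≡)))
            (≈-trans (≈-drop n≈0) (≈-sym (≈-drop (≈-trans (≡⇒≈ t+i≡) ℓ≈0))))))) (≡⇒≈ refl)

    -- A period d exceeding one of the two arcs cut off by the chord yields a smaller period by gcd.
    descend : ∀ d → Acc _<_ d → 0 < d → Period c d → d ∣ ℓ → d ∣ N → Bichromatic ⊎ Period c 2
    descend-gcd : ∀ {d} → (∀ {d′} → d′ < d → Acc _<_ d′) → 0 < d → Period c d → d ∣ ℓ → d ∣ N →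
      ∀ e → 0 < e → e < d → Period c e → Bichromatic ⊎ Period c 2

    descend (suc d) (acc rs) 0<d per d∣ℓ d∣n = cases (suc d ≤? r) (r + suc d ≤? N)
      where
      cases : Dec (suc d ≤ r) → Dec (r + suc d ≤ N) → Bichromatic ⊎ Period c 2
      cases (yes d≤r) (yes r+d≤n) = reflections d per d∣ℓ d∣n d≤r r+d≤n
      cases (no d≰r)  _           = [ inj₁ , descend-gcd rs 0<d per d∣ℓ d∣n (r ∸ 1) (m<n⇒0<n∸m 2≤r) r-1<d ]′
        (short-chord d per d∣ℓ d∣n (sym (m+[n∸m]≡n (<⇒≤ 2≤r))) (≤-pred (≰⇒> d≰r)))
        where
        r-1<d : r ∸ 1 < suc d
        r-1<d = ≤-<-trans (m∸n≤m r 1) (≰⇒> d≰r)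
      cases (yes _) (no r+d≰n)    = [ inj₁ , descend-gcd rs 0<d per d∣ℓ d∣n (b ∸ r) (m<n⇒0<n∸m r<b) (m<n⇒m<1+n e<d) ]′
        (long-chord d per d∣ℓ d∣n (trans (+-suc r _) (cong suc (m+[n∸m]≡n (<⇒≤ r<b)))) e<d)
        where
        e<d : b ∸ r < d
        e<d = +-cancelˡ-< r _ _ (≤-<-trans (≤-reflexive (m+[n∸m]≡n (<⇒≤ r<b)))
          (≤-pred (≤-trans (≰⇒> r+d≰n) (≤-reflexive (+-suc r d)))))
    descend-gcd {d} rs 0<d per d∣ℓ d∣n e 0<e e<d per-e = descend (gcd d e)
      (rs (≤-<-trans (∣⇒≤ {{>-nonZero 0<e}} (gcd[m,n]∣n d e)) e<d))
      (n≢0⇒n>0 (gcd[m,n]≢0 d e (inj₁ (m<n⇒n≢0 0<d))))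
      (period-gcd per per-e) (∣-trans (gcd[m,n]∣m d e) d∣ℓ) (∣-trans (gcd[m,n]∣m d e) d∣n)

    -- If no bichromatic path exists, moving along the cycle makes `ℓ` a period; together with `N`
    -- this gives the period `gcd ℓ N`, from which the descent starts.
    bichromatic-path : Bichromatic ⊎ (Period c ℓ × Period c 2)
    bichromatic-path = [ inj₁ , finish ]′ (either-all N along)
      where
      finish : (∀ x → x < N → c (x + ℓ) ≡ c x) → Bichromatic ⊎ (Period c ℓ × Period c 2)
      finish f = map₂ (per-ℓ ,_) (descend (gcd ℓ N) (<-wellFounded _)
        (n≢0⇒n>0 (gcd[m,n]≢0 ℓ N (inj₁ (m<n⇒n≢0 0<ℓ))))
        (period-gcd per-ℓ c-period) (gcd[m,n]∣m ℓ N) (gcd[m,n]∣n ℓ N))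
        where
        per-ℓ : Period c ℓ
        per-ℓ x = let (t , t<n , t≈x) = residue b 0 x in
          trans (period-≈ c-period (+-≈ (≈-sym t≈x) (≡⇒≈ refl)))
                (trans (f t t<n) (period-≈ c-period t≈x))

-- Dense graphs contain subgraphs of large minimum degree

⟦_⟧ : Bool → ℕ
⟦ b ⟧ = if b then 1 else 0

⟦⟧≤1 : ∀ b → ⟦ b ⟧ ≤ 1
⟦⟧≤1 true  = ≤-refl
⟦⟧≤1 false = z≤n

⟦∧⟧≤ˡ : ∀ a b → ⟦ a ∧ b ⟧ ≤ ⟦ a ⟧
⟦∧⟧≤ˡ true  b = ⟦⟧≤1 b
⟦∧⟧≤ˡ false b = z≤n

⟦∧⟧≤ʳ : ∀ a b → ⟦ a ∧ b ⟧ ≤ ⟦ b ⟧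
⟦∧⟧≤ʳ true  b = ≤-refl
⟦∧⟧≤ʳ false b = z≤n

sum-mono-≤ : ∀ {n} {f g : Fin n → ℕ} → (∀ i → f i ≤ g i) → sum f ≤ sum g
sum-mono-≤ {zero}  f≤g = z≤n
sum-mono-≤ {suc n} f≤g = +-mono-≤ (f≤g zero) (sum-mono-≤ (f≤g ∘ suc))

sum-0 : ∀ {n} {f : Fin n → ℕ} → (∀ i → f i ≡ 0) → sum f ≡ 0
sum-0 {zero}  f≡0 = refl
sum-0 {suc n} f≡0 = cong₂ _+_ (f≡0 zero) (sum-0 (f≡0 ∘ suc))

term≤sum : ∀ {n} (f : Fin n → ℕ) i → f i ≤ sum f
term≤sum f zero    = m≤m+n _ _
term≤sum f (suc i) = ≤-trans (term≤sum (f ∘ suc) i) (m≤n+m _ (f zero))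

sum-δ : ∀ {n} v (f : Fin n → ℕ) → sum (λ u → if ⌊ v Fin.≟ u ⌋ then f u else 0) ≡ f v
sum-δ zero    f = trans (cong (f zero +_) (sum-0 {f = λ u → if ⌊ zero Fin.≟ suc u ⌋ then f (suc u) else 0} (λ _ → refl))) (+-identityʳ _)
sum-δ (suc v) f = trans (sum-cong-≗ shift) (sum-δ v (f ∘ suc))
  where
  shift : ∀ u → (if ⌊ suc v Fin.≟ suc u ⌋ then f (suc u) else 0) ≡ (if ⌊ v Fin.≟ u ⌋ then f (suc u) else 0)
  shift u with v Fin.≟ u
  ... | yes _ = refl
  ... | no  _ = refl

module Core {n : ℕ} (E : Fin n → Fin n → Bool)
  (E-sym : ∀ u v → E u v ≡ E v u) (E-irrefl : ∀ u → E u u ≡ false) where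

  degree : (Fin n → Bool) → Fin n → ℕ
  degree S v = sum (λ u → ⟦ S u ∧ E v u ⟧)

  size : (Fin n → Bool) → ℕ
  size S = sum (λ u → ⟦ S u ⟧)

  -- Twice the number of edges induced by `S`.
  volume : (Fin n → Bool) → ℕ
  volume S = sum (λ u → if S u then degree S u else 0)

  remove : Fin n → (Fin n → Bool) → Fin n → Bool
  remove v S u = S u ∧ not ⌊ v Fin.≟ u ⌋

  split-at : ∀ {v} S → S v ≡ true → (f : Fin n → ℕ) →
    sum (λ u → if S u then f u else 0) ≡ sum (λ u → if remove v S u then f u else 0) + f v
  split-at {v} S Sv f = trans (sum-cong-≗ pointwise) (trans (∑-distrib-+ rest peak) (cong (sum rest +_) (sum-δ v f)))
    where
    rest peak : Fin n → ℕ
    rest u = if remove v S u then f u else 0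
    peak u = if ⌊ v Fin.≟ u ⌋ then f u else 0
    pointwise : ∀ u → (if S u then f u else 0) ≡ (if remove v S u then f u else 0) + (if ⌊ v Fin.≟ u ⌋ then f u else 0)
    pointwise u with v Fin.≟ u
    ... | yes refl rewrite Sv = refl
    ... | no  _ = trans (cong (if_then f u else 0) (sym (Bool.∧-identityʳ (S u)))) (sym (+-identityʳ _))

  size-remove : ∀ {v} S → S v ≡ true → size S ≡ size (remove v S) + 1
  size-remove S Sv = split-at S Sv (λ _ → 1)

  ⟦∧⟧-if : ∀ a b → ⟦ a ∧ b ⟧ ≡ (if a then ⟦ b ⟧ else 0)
  ⟦∧⟧-if true  b = refl
  ⟦∧⟧-if false b = refl

  degree-remove : ∀ {v} S → S v ≡ true → ∀ u → degree S u ≡ degree (remove v S) u + ⟦ E u v ⟧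
  degree-remove {v} S Sv u = begin
    degree S u                                                   ≡⟨ sum-cong-≗ (λ w → ⟦∧⟧-if (S w) (E u w)) ⟩
    sum (λ w → if S w then ⟦ E u w ⟧ else 0)                     ≡⟨ split-at S Sv (λ w → ⟦ E u w ⟧) ⟩
    sum (λ w → if remove v S w then ⟦ E u w ⟧ else 0) + ⟦ E u v ⟧
      ≡⟨ cong (_+ ⟦ E u v ⟧) (sum-cong-≗ (λ w → sym (⟦∧⟧-if (remove v S w) (E u w)))) ⟩
    degree (remove v S) u + ⟦ E u v ⟧                            ∎
    where open ≡-Reasoning

  -- Deleting `v` loses its own degree and one unit at each of its remaining neighbours.
  volume-remove : ∀ {v} S → S v ≡ true → volume S ≤ volume (remove v S) + 2 * degree S v
  volume-remove {v} S Sv = begin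
    volume S                                                       ≡⟨ split-at S Sv (degree S) ⟩
    sum (λ u → if S′ u then degree S u else 0) + degree S v         ≡⟨ cong (_+ degree S v) (sum-cong-≗ expand) ⟩
    sum (λ u → (if S′ u then degree S′ u else 0) + ⟦ S′ u ∧ E v u ⟧) + degree S v
                                                                   ≡⟨ cong (_+ degree S v) (∑-distrib-+ (λ u → if S′ u then degree S′ u else 0) (λ u → ⟦ S′ u ∧ E v u ⟧)) ⟩
    volume S′ + degree S′ v + degree S v                           ≤⟨ +-monoˡ-≤ (degree S v) (+-monoʳ-≤ (volume S′) shrink) ⟩
    volume S′ + degree S v + degree S v                            ≡⟨ twice (volume S′) (degree S v) ⟩
    volume S′ + 2 * degree S v                                     ∎
    where
    open ≤-Reasoning
    S′ = remove v S
    twice : ∀ a b → a + b + b ≡ a + 2 * b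
    twice = solve-∀
    shrink : degree S′ v ≤ degree S v
    shrink = ≤-trans (m≤m+n _ _) (≤-reflexive (sym (degree-remove S Sv v)))
    expand : ∀ u → (if S′ u then degree S u else 0) ≡ (if S′ u then degree S′ u else 0) + ⟦ S′ u ∧ E v u ⟧
    expand u with S′ u
    ... | false = refl
    ... | true  = trans (degree-remove S Sv u) (cong (λ b → degree S′ u + ⟦ b ⟧) (E-sym u v))

  HasCore : ℕ → Set
  HasCore k = ∃ λ S → (∃ λ v → S v ≡ true) × (∀ v → S v ≡ true → suc k ≤ degree S v)

  member : ∀ S → 1 ≤ size S → ∃ λ v → S v ≡ true
  member S 1≤size with Fin.any? (λ v → S v Bool.≟ true)
  ... | yes found = found
  ... | no  none  = ⊥-elim (<⇒≱ 1≤size (≤-reflexive (sum-0 λ v → cong ⟦_⟧ (Bool.¬-not (none ∘ (v ,_))))))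

  -- Peel off vertices of degree at most k: the bound 2k|S| ≤ vol S survives each step.
  peel : ∀ {k} → 1 ≤ k → ∀ m S → size S ≡ suc m → 2 * k * size S ≤ volume S → HasCore k
  peel {k} 1≤k m S size≡ dense with Fin.any? (λ v → (S v Bool.≟ true) ×-dec (degree S v ≤? k))
  ... | no none = S , member S (≤-trans (s≤s z≤n) (≤-reflexive (sym size≡))) ,
                  λ v Sv → ≰⇒> (none ∘ (λ le → v , Sv , le))
  ... | yes (v , Sv , deg≤k) = go m (suc-injective (trans (+-comm 1 _) (trans (sym (size-remove S Sv)) size≡)))
    where
    S′ = remove v S
    dense′ : 2 * k * size S′ ≤ volume S′
    dense′ = +-cancelʳ-≤ (2 * k) _ _ (begin
      2 * k * size S′ + 2 * k     ≡⟨ collect k (size S′) ⟩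
      2 * k * (size S′ + 1)       ≡⟨ cong (2 * k *_) (size-remove S Sv) ⟨
      2 * k * size S              ≤⟨ dense ⟩
      volume S                    ≤⟨ volume-remove S Sv ⟩
      volume S′ + 2 * degree S v  ≤⟨ +-monoʳ-≤ (volume S′) (*-monoʳ-≤ 2 deg≤k) ⟩
      volume S′ + 2 * k           ∎)
      where
      open ≤-Reasoning
      collect : ∀ a b → 2 * a * b + 2 * a ≡ 2 * a * (b + 1)
      collect = solve-∀
    go : ∀ m → size S′ ≡ m → HasCore k
    go (suc m) eq = peel 1≤k m S′ eq dense′
    -- If `v` were the only vertex left, irreflexivity would make the volume `0`, against
    -- `2 * k ≤ volume S`.
    go zero    eq = ⊥-elim (<⇒≱ 1≤k (*-cancelˡ-≤ 2 (begin
      2 * k                       ≡⟨ *-identityʳ (2 * k) ⟨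
      2 * k * 1                   ≡⟨ cong (2 * k *_) (trans (size-remove S Sv) (cong (_+ 1) eq)) ⟨
      2 * k * size S              ≤⟨ dense ⟩
      volume S                    ≤⟨ volume-remove S Sv ⟩
      volume S′ + 2 * degree S v  ≡⟨ cong₂ (λ a b → a + 2 * b) volume≡0 degree≡0 ⟩
      2 * 0                       ∎)))
      where
      open ≤-Reasoning
      outside : ∀ u → ⟦ S′ u ⟧ ≡ 0
      outside u = n≤0⇒n≡0 (subst (⟦ S′ u ⟧ ≤_) eq (term≤sum (λ u → ⟦ S′ u ⟧) u))
      volume≡0 : volume S′ ≡ 0
      volume≡0 = sum-0 vanish
        where
        vanish : ∀ u → (if S′ u then degree S′ u else 0) ≡ 0
        vanish u with S′ u | outside u
        ... | false | _ = refl
      degree≡0 : degree S v ≡ 0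
      degree≡0 = trans (degree-remove S Sv v) (cong₂ _+_
        (sum-0 (λ u → n≤0⇒n≡0 (≤-trans (⟦∧⟧≤ˡ (S′ u) (E v u)) (≤-reflexive (outside u)))))
        (cong ⟦_⟧ (E-irrefl v)))

  core : ∀ {k} → 1 ≤ k → Fin n → 2 * k * n ≤ sum (λ u → sum (λ v → ⟦ E u v ⟧)) → HasCore k
  core {k} 1≤k v dense = nonempty n refl
    where
    size-all : ∀ m → sum {m} (λ _ → 1) ≡ m
    size-all zero    = refl
    size-all (suc m) = cong suc (size-all m)
    nonempty : ∀ m → m ≡ n → HasCore k
    nonempty zero    refl = ⊥-elim (Fin.¬Fin0 v)
    nonempty (suc m) refl = peel 1≤k m (λ _ → true) (size-all n)
      (≤-trans (≤-reflexive (cong (2 * k *_) (size-all n))) dense)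

-- Counting edges and dividing them into three classes

∑∑ : ∀ {n} → (Fin n → Fin n → ℕ) → ℕ
∑∑ f = sum (λ i → sum (f i))

∑∑-cong : ∀ {n} {f g : Fin n → Fin n → ℕ} → (∀ i j → f i j ≡ g i j) → ∑∑ f ≡ ∑∑ g
∑∑-cong f≡g = sum-cong-≗ (λ i → sum-cong-≗ (f≡g i))

∑∑-+ : ∀ {n} (f g : Fin n → Fin n → ℕ) → ∑∑ (λ i j → f i j + g i j) ≡ ∑∑ f + ∑∑ g
∑∑-+ f g = trans (sum-cong-≗ (λ i → ∑-distrib-+ (f i) (g i))) (∑-distrib-+ (sum ∘ f) (sum ∘ g))

sum-map-allFin : ∀ {n} (f : Fin n → ℕ) → List.sum (List.map f (List.allFin n)) ≡ sum f
sum-map-allFin f = trans (cong List.sum (List.map-tabulate id f)) (tabulated f)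
  where
  tabulated : ∀ {n} (f : Fin n → ℕ) → List.sum (List.tabulate f) ≡ sum f
  tabulated {zero}  f = refl
  tabulated {suc n} f = cong (f zero +_) (tabulated (f ∘ suc))

-- The sum over `i < j` plus its transpose counts each ordered adjacent pair once, and the diagonal
-- contributes nothing.
handshake : ∀ G → 2 * edgeCount G ≡ ∑∑ (λ u v → ⟦ adj G u v ⟧)
handshake G = begin
  2 * edgeCount G                              ≡⟨ cong (2 *_) edgeCount≡ ⟩
  2 * ∑∑ up                                    ≡⟨ cong (∑∑ up +_) (+-identityʳ (∑∑ up)) ⟩
  ∑∑ up + ∑∑ up                                ≡⟨ cong (∑∑ up +_) (∑-comm up) ⟩
  ∑∑ up + ∑∑ (λ i j → up j i)                  ≡⟨ ∑∑-+ up (λ i j → up j i) ⟨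
  ∑∑ (λ i j → up i j + up j i)                 ≡⟨ ∑∑-cong both ⟩
  ∑∑ (λ u v → ⟦ adj G u v ⟧)                   ∎
  where
  open ≡-Reasoning
  up : Fin (n G) → Fin (n G) → ℕ
  up i j = if ⌊ i Fin.<? j ⌋ ∧ adj G i j then 1 else 0
  edgeCount≡ : edgeCount G ≡ ∑∑ up
  edgeCount≡ = trans (sum-map-allFin (λ i → List.sum (List.map (up i) (List.allFin (n G))))) (sum-cong-≗ (λ i → sum-map-allFin (up i)))
  both : ∀ i j → up i j + up j i ≡ ⟦ adj G i j ⟧
  both i j = count (i Fin.<? j) (j Fin.<? i)
    where
    count : (d : Dec (i Fin.< j)) (e : Dec (j Fin.< i)) →
      (if ⌊ d ⌋ ∧ adj G i j then 1 else 0) + (if ⌊ e ⌋ ∧ adj G j i then 1 else 0) ≡ ⟦ adj G i j ⟧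
    count (yes i<j) (yes j<i) = ⊥-elim (<-asym i<j j<i)
    count (yes _)   (no _)    = +-identityʳ _
    count (no _)    (yes _)   = cong ⟦_⟧ (Graph.sym G j i)
    count (no i≮j)  (no j≮i)  = sym (cong ⟦_⟧ (trans (cong (adj G i)
      (Fin.toℕ-injective (≤-antisym (≮⇒≥ i≮j) (≮⇒≥ j≮i)))) (irrefl G i)))

⟦⟧-split : ∀ a p q → ⟦ a ⟧ ≡ ⟦ a ∧ p ⟧ + (⟦ a ∧ (not p ∧ q) ⟧ + ⟦ a ∧ (not p ∧ not q) ⟧)
⟦⟧-split false _     _     = refl
⟦⟧-split true  true  _     = refl
⟦⟧-split true  false true  = refl
⟦⟧-split true  false false = refl

one-of-three : ∀ {m} a b c → m + (m + m) ≤ a + (b + c) → m ≤ a ⊎ (m ≤ b ⊎ m ≤ c)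
one-of-three {m} a b c le with m ≤? a | m ≤? b | m ≤? c
... | yes m≤a | _       | _       = inj₁ m≤a
... | no  _   | yes m≤b | _       = inj₂ (inj₁ m≤b)
... | no  _   | no  _   | yes m≤c = inj₂ (inj₂ m≤c)
... | no  m≰a | no  m≰b | no  m≰c =
  ⊥-elim (<⇒≱ (+-mono-< (≰⇒> m≰a) (+-mono-< (≰⇒> m≰b) (≰⇒> m≰c))) le)

-- Breadth-first forests

least : ∀ {P : ℕ → Set} → (∀ m → Dec (P m)) → ∀ {m} → P m → ∃ λ l → P l × (∀ {i} → i < l → ¬ P i)
least P? {m} Pm with P? 0
least P? {m}     Pm | yes P0 = 0 , P0 , λ ()
least P? {zero}  Pm | no ¬P0 = ⊥-elim (¬P0 Pm)
least P? {suc m} Pm | no ¬P0 with least (P? ∘ suc) Pm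
... | l , Pl , below = suc l , Pl , λ { {zero} _ → ¬P0 ; {suc i} (s≤s i<l) → below i<l }

leastFin : ∀ {n} {P : Fin n → Set} → (∀ i → Dec (P i)) → ∃ P → ∃ λ l → P l × (∀ {i} → P i → l Fin.≤ i)
leastFin {suc n} P? (i , Pi) with P? zero
leastFin {suc n} P? (i , Pi)     | yes P0 = zero , P0 , λ _ → z≤n
leastFin {suc n} P? (zero , P0)  | no ¬P0 = ⊥-elim (¬P0 P0)
leastFin {suc n} P? (suc i , Pi) | no ¬P0 with leastFin (P? ∘ suc) (i , Pi)
... | l , Pl , below = suc l , Pl , λ { {zero} P0 → ⊥-elim (¬P0 P0) ; {suc j} Pj → s≤s (below Pj) }

-- What later arguments need from a breadth-first search. `parent` is constrained at positive levels
-- only, and `root` names one vertex per component.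
record Forest (G : Graph) : Set where
  field
    level        : Fin (n G) → ℕ
    parent       : Fin (n G) → Fin (n G)
    root         : Fin (n G) → Fin (n G)
    level-adj    : ∀ {u v} → Adj G u v → level v ≤ suc (level u)
    parent-adj   : ∀ {v i} → level v ≡ suc i → Adj G v (parent v)
    parent-level : ∀ {v i} → level v ≡ suc i → level (parent v) ≡ i
    root-adj     : ∀ {u v} → Adj G u v → root u ≡ root v
    root-level   : ∀ {v} → level v ≡ 0 → root v ≡ v

module BreadthFirst (G : Graph) where

  V : Set
  V = Fin (n G)

  Ball : V → ℕ → V → Set
  Ball r zero    v = v ≡ r
  Ball r (suc t) v = Ball r t v ⊎ ∃ λ u → Ball r t u × Adj G u v

  ball? : ∀ r t v → Dec (Ball r t v)
  ball? r zero    v = v Fin.≟ r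
  ball? r (suc t) v = ball? r t v ⊎-dec Fin.any? (λ u → ball? r t u ×-dec (adj G u v Bool.≟ true))

  ball-mono : ∀ {r s t v} → s ≤ t → Ball r s v → Ball r t v
  ball-mono {s = zero}  {zero}  _         b = b
  ball-mono {s = zero}  {suc t} _         b = inj₁ (ball-mono {t = t} z≤n b)
  ball-mono {s = suc s} {suc t} (s≤s s≤t) (inj₁ b)           = inj₁ (ball-mono s≤t b)
  ball-mono {s = suc s} {suc t} (s≤s s≤t) (inj₂ (u , b , a)) = inj₂ (u , ball-mono s≤t b , a)

  Stable : V → ℕ → Set
  Stable r t = ∀ v → Ball r (suc t) v → Ball r t v

  Fresh : V → ℕ → V → Set
  Fresh r t v = Ball r (suc t) v × ¬ Ball r t v

  fresh? : ∀ r t v → Dec (Fresh r t v)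
  fresh? r t v = ball? r (suc t) v ×-dec ¬? (ball? r t v)

  -- If all radii up to `n G` brought in a new vertex, two of these vertices would coincide by the
  -- pigeonhole principle; but a vertex once reached lies in all larger balls.
  stabilises : ∀ r → ∃ (Stable r)
  stabilises r = cases (Fin.any? {suc (n G)} (λ t → ¬? (Fin.any? (fresh? r (toℕ t)))))
    where
    cases : Dec (∃ λ (t : Fin (suc (n G))) → ¬ ∃ (Fresh r (toℕ t))) → ∃ (Stable r)
    cases (yes (t , none)) = toℕ t , λ v b → stays v b (ball? r (toℕ t) v)
      where
      stays : ∀ v → Ball r (suc (toℕ t)) v → Dec (Ball r (toℕ t) v) → Ball r (toℕ t) v
      stays v b (yes b′) = b′
      stays v b (no ¬b)  = ⊥-elim (none (v , b , ¬b))
    cases (no always) = ⊥-elim (repeat (Fin.pigeonhole ≤-refl (proj₁ ∘ fresh)))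
      where
      fresh : ∀ (t : Fin (suc (n G))) → ∃ (Fresh r (toℕ t))
      fresh t = found (Fin.any? (fresh? r (toℕ t)))
        where
        found : Dec (∃ (Fresh r (toℕ t))) → ∃ (Fresh r (toℕ t))
        found (yes f) = f
        found (no ¬f) = ⊥-elim (always (t , ¬f))
      repeat : ¬ ∃₂ λ i j → i Fin.< j × proj₁ (fresh i) ≡ proj₁ (fresh j)
      repeat (i , j , i<j , eq) = proj₂ (proj₂ (fresh j))
        (subst (Ball r (toℕ j)) eq (ball-mono i<j (proj₁ (proj₂ (fresh i)))))

  radius : V → ℕ
  radius r = proj₁ (stabilises r)

  Reaches : V → V → Set
  Reaches r v = Ball r (radius r) v

  reaches? : ∀ v r → Dec (Reaches r v)
  reaches? v r = ball? r (radius r) v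

  reaches-refl : ∀ v → Reaches v v
  reaches-refl v = ball-mono {v} {0} {radius v} z≤n refl

  reaches-adj : ∀ {r u v} → Adj G u v → Reaches r u → Reaches r v
  reaches-adj {r} {u} {v} a b = proj₂ (stabilises r) v (inj₂ (u , b , a))

  adj-sym : ∀ {u v} → Adj G u v → Adj G v u
  adj-sym {u} {v} a = trans (Graph.sym G v u) a

  -- Taking the least vertex that reaches `v` makes adjacent vertices choose the same root.
  origin : ∀ v → ∃ λ r → Reaches r v × (∀ {i} → Reaches i v → r Fin.≤ i)
  origin v = leastFin (reaches? v) (v , reaches-refl v)

  root : V → V
  root v = proj₁ (origin v)

  root-adj : ∀ {u v} → Adj G u v → root u ≡ root v
  root-adj {u} {v} a = Fin.toℕ-injective (≤-antisym
    (proj₂ (proj₂ (origin u)) (reaches-adj (adj-sym a) (proj₁ (proj₂ (origin v)))))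
    (proj₂ (proj₂ (origin v)) (reaches-adj a (proj₁ (proj₂ (origin u))))))

  depth : ∀ v → ∃ λ l → Ball (root v) l v × (∀ {i} → i < l → ¬ Ball (root v) i v)
  depth v = least (λ t → ball? (root v) t v) {radius (root v)} (proj₁ (proj₂ (origin v)))

  level : V → ℕ
  level v = proj₁ (depth v)

  level-ball : ∀ v → Ball (root v) (level v) v
  level-ball v = proj₁ (proj₂ (depth v))

  level-least : ∀ {v t} → Ball (root v) t v → level v ≤ t
  level-least {v} {t} b = ≮⇒≥ (λ t<l → proj₂ (proj₂ (depth v)) t<l b)

  level-adj : ∀ {u v} → Adj G u v → level v ≤ suc (level u)
  level-adj {u} {v} a = level-least (subst (λ r → Ball r (suc (level u)) v) (root-adj a)
    (inj₂ (u , level-ball u , a)))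

  -- The last step of a shortest walk from the root comes from a vertex exactly one level lower; a
  -- nearer predecessor would bring `v` nearer too.
  ancestor : ∀ v → ∃ λ p → ∀ {i} → level v ≡ suc i → Adj G v p × level p ≡ i
  ancestor v = find (level v) refl (level-ball v)
    where
    find : ∀ l → level v ≡ l → Ball (root v) l v → ∃ λ p → ∀ {i} → level v ≡ suc i → Adj G v p × level p ≡ i
    -- At a root `v` itself is a default value, and the requirement on it is vacuous.
    find zero    l≡ _ = v , λ eq → ⊥-elim (0≢1+n (trans (sym l≡) eq))
    find (suc l) l≡ (inj₁ b) = ⊥-elim (1+n≰n (≤-trans (≤-reflexive (sym l≡)) (level-least b)))
    find (suc l) l≡ (inj₂ (u , b , a)) = u , λ eq → adj-sym a , trans
      (≤-antisym (level-least (subst (λ r → Ball r l u) (sym (root-adj a)) b))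
                 (≤-pred (≤-trans (≤-reflexive (sym l≡)) (level-adj a))))
      (suc-injective (trans (sym l≡) eq))

  forest : Forest G
  forest = record
    { level        = level
    ; parent       = proj₁ ∘ ancestor
    ; root         = root
    ; level-adj    = level-adj
    ; parent-adj   = λ {v} eq → proj₁ (proj₂ (ancestor v) eq)
    ; parent-level = λ {v} eq → proj₂ (proj₂ (ancestor v) eq)
    ; root-adj     = root-adj
    ; root-level   = λ {v} eq → sym (subst (λ t → Ball (root v) t v) eq (level-ball v)) }

-- Long cycles with a chord

closed-path : ∀ {G P x y ℓ} → Path (Adj G) P x y ℓ → 2 ≤ ℓ → Adj G y x → HasCycle G (suc ℓ)
closed-path {G} {ℓ = ℓ} p 2≤ℓ y~x = s≤s 2≤ℓ , at p ∘ toℕ ,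
  (λ {i} {j} eq → Fin.toℕ-injective (distinct p (Fin.toℕ≤pred[n] i) (Fin.toℕ≤pred[n] j) eq)) ,
  (λ i → subst (λ z → Adj G (at p z) (at p (suc (toℕ i)))) (sym (Fin.toℕ-inject₁ i)) (linked p (Fin.toℕ<n i))) ,
  subst₂ (Adj G) (sym (trans (cong (at p) (Fin.toℕ-fromℕ ℓ)) (target p))) (sym (source p)) y~x

subpath : ∀ {X : Set} {_~_ : X → X → Set} {P x y L} (p : Path _~_ P x y L) {a i} → a + i ≤ L →
  Path _~_ (λ v → ∃ λ t → a ≤ t × t ≤ L × v ≡ at p t) (at p a) (at p (a + i)) i
subpath {_~_ = _~_} {L = L} p {a} {i} a+i≤L = record
  { at       = λ t → at p (a + t)
  ; source   = cong (at p) (+-identityʳ a)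
  ; target   = refl
  ; distinct = λ {s} {t} s≤i t≤i eq → +-cancelˡ-≡ a s t (distinct p (within s≤i) (within t≤i) eq)
  ; linked   = λ {t} t<i → subst (λ z → at p (a + t) ~ at p z) (sym (+-suc a t))
                 (linked p (≤-trans (≤-reflexive (sym (+-suc a t))) (within t<i)))
  ; inside   = λ {t} t≤i → a + t , m≤m+n a t , within t≤i , refl }
  where
  within : ∀ {t} → t ≤ i → a + t ≤ L
  within t≤i = ≤-trans (+-monoʳ-≤ a t≤i) a+i≤L

-- Remembers a position for each vertex, so that a vertex off the path can be joined to it.
traced : ∀ {X : Set} {_~_ : X → X → Set} {P x y L} (p : Path _~_ P x y L) →
  Path _~_ (λ v → P v × ∃ λ t → t ≤ L × v ≡ at p t) x y L
traced p = record
  { at = at p ; source = source p ; target = target p ; distinct = distinct p ; linked = linked p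
  ; inside = λ {t} t≤L → inside p t≤L , t , t≤L , refl }

-- `last` is the index of the final vertex, so the cycle has `suc last` vertices; the chord issues
-- from vertex `0`.
record ChordedCycle {X : Set} (_~_ : X → X → Set) : Set where
  field
    last end : ℕ
    vertex   : ℕ → X
    2≤end    : 2 ≤ end
    end<last : end < last
    injective : ∀ {i j} → i ≤ last → j ≤ last → vertex i ≡ vertex j → i ≡ j
    step     : ∀ {i} → i < last → vertex i ~ vertex (suc i)
    close    : vertex last ~ vertex 0
    chord    : vertex 0 ~ vertex end

hits : (ℕ → Bool) → ℕ → ℕ
hits f t = sum {t} (λ z → ⟦ f (toℕ z) ⟧)

next-hit : ∀ f t {c} → suc c ≤ hits f t →
  ∃₂ λ s t′ → f s ≡ true × s + suc t′ ≡ t × c ≤ hits (λ z → f (s + suc z)) t′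
next-hit f (suc t) le with f 0 in f0
... | true  = 0 , t , f0 , refl , ≤-pred le
... | false with next-hit (f ∘ suc) t le
...   | s , t′ , fs , eq , le′ = suc s , t′ , fs , cong suc eq , le′

module LongCycle (G : Graph) (g : ℕ) (girth : ∀ ℓ → ℓ < g → ¬ HasCycle G ℓ) (3≤g : 3 ≤ g)
  (E : Fin (n G) → Fin (n G) → Bool) (E⊆Adj : ∀ {u v} → E u v ≡ true → Adj G u v)
  (E-irrefl : ∀ u → E u u ≡ false) (E-sym : ∀ u v → E u v ≡ E v u) where

  open Core E E-sym E-irrefl using (degree; HasCore)

  V : Set
  V = Fin (n G)

  _~_ : V → V → Set
  u ~ v = E u v ≡ true

  Covers : (V → Bool) → ∀ {P x y L} → Path _~_ P x y L → Set
  Covers S {x = x} {L = L} p = ∀ u → S u ≡ true → x ~ u → ∃ λ t → t ≤ L × u ≡ at p t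

  -- The path is extended at its source until no neighbour there is new, and this maximality is all
  -- that is used. With no fuel left it would have more than `n G` distinct vertices.
  longest : ∀ S fuel {x y L} → n G ≤ L + fuel → Path _~_ (λ v → S v ≡ true) x y L →
    ∃₂ λ x y → ∃₂ λ L (p : Path _~_ (λ v → S v ≡ true) x y L) → Covers S p
  longest S zero {L = L} n≤L p = ⊥-elim (<⇒≱ (Fin.injective⇒≤ {f = at p ∘ toℕ} λ {i} {j} eq →
    Fin.toℕ-injective (distinct p (Fin.toℕ≤pred[n] i) (Fin.toℕ≤pred[n] j) eq))
    (≤-trans n≤L (≤-reflexive (+-identityʳ L))))
  longest S (suc fuel) {x} {y} {L} n≤L p = cases (Fin.any? fresh?)
    where
    OnPath Fresh : V → Set
    OnPath u = ∃ λ (t : Fin (suc L)) → u ≡ at p (toℕ t)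
    Fresh u = S u ≡ true × x ~ u × ¬ OnPath u
    onPath? : ∀ u → Dec (OnPath u)
    onPath? u = Fin.any? (λ t → u Fin.≟ at p (toℕ t))
    fresh? : ∀ u → Dec (Fresh u)
    fresh? u = (S u Bool.≟ true) ×-dec ((E x u Bool.≟ true) ×-dec ¬? (onPath? u))
    cases : Dec (∃ Fresh) → ∃₂ λ x y → ∃₂ λ L (p : Path _~_ (λ v → S v ≡ true) x y L) → Covers S p
    cases (yes (u , Su , x~u , off)) = longest S fuel (≤-trans n≤L (≤-reflexive (+-suc L fuel)))
      (join (trivial {P = _≡ u} refl) (trans (E-sym u x) x~u) (traced p)
        (λ { refl (_ , t , t≤L , u≡) → off (fromℕ< (s≤s t≤L) ,
               trans u≡ (cong (at p) (sym (Fin.toℕ-fromℕ< (s≤s t≤L))))) })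
        (λ { refl → Su }) proj₁)
    cases (no none) = x , y , L , p , λ u Su x~u → locate u Su x~u (onPath? u)
      where
      locate : ∀ u → S u ≡ true → x ~ u → Dec (OnPath u) → ∃ λ t → t ≤ L × u ≡ at p t
      locate u Su x~u (yes (t , u≡)) = toℕ t , Fin.toℕ≤pred[n] t , u≡
      locate u Su x~u (no off)       = ⊥-elim (none (u , Su , x~u , off))

  -- Two neighbours of the first vertex close a cycle with the stretch of the path between them.
  gap : ∀ {P x y L} (p : Path _~_ P x y L) {a b} → 1 ≤ a → a < b → b ≤ L →
        x ~ at p a → x ~ at p b → a + (g ∸ 2) ≤ b
  gap {x = x} {L = L} p {a} {b} 1≤a a<b b≤L x~a x~b = begin
    a + (g ∸ 2)         ≤⟨ +-monoʳ-≤ a (∸-monoˡ-≤ 2 (≮⇒≥ (λ short → girth _ short cycle))) ⟩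
    a + (b ∸ a)         ≡⟨ m+[n∸m]≡n (<⇒≤ a<b) ⟩
    b                   ∎
    where
    open ≤-Reasoning
    a+≡b : a + (b ∸ a) ≡ b
    a+≡b = m+[n∸m]≡n (<⇒≤ a<b)
    cycle : HasCycle G (2 + (b ∸ a))
    cycle = closed-path {G}
      (embed {Q = λ _ → ⊤} id (λ _ _ → id) E⊆Adj (λ _ → tt)
        (join {R = λ _ → ⊤} (trivial {P = _≡ x} refl) x~a
          (subpath p {a} {b ∸ a} (≤-trans (≤-reflexive a+≡b) b≤L))
          (λ { refl (t , a≤t , t≤L , x≡) → <⇒≱ 1≤a (≤-trans a≤t
                 (≤-reflexive (distinct p t≤L z≤n (trans (sym x≡) (sym (source p)))))) })
          (λ _ → tt) (λ _ → tt)))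
      (s≤s (m<n⇒0<n∸m a<b))
      (E⊆Adj (trans (E-sym (at p (a + (b ∸ a))) x) (subst (λ z → x ~ at p z) (sym a+≡b) x~b)))

  -- Each neighbour in `S` is charged to a position it occupies; exchanging the sums leaves a count
  -- of positions.
  neighbours-on-path : ∀ S {P x y L} (p : Path _~_ P x y L) → Covers S p →
    degree S x ≤ hits (λ z → E x (at p (suc z))) L
  neighbours-on-path S {x = x} {L = L} p cov = begin
    sum (λ u → ⟦ S u ∧ E x u ⟧)                  ≤⟨ sum-mono-≤ (λ u → bound u (S u Bool.≟ true) (E x u Bool.≟ true)) ⟩
    sum (λ u → sum (λ t → term t u))             ≡⟨ ∑-comm (λ u t → term t u) ⟩
    sum (λ t → sum (term t))                     ≡⟨ sum-cong-≗ (λ t → sum-δ (pos t) (λ u → ⟦ E x u ⟧)) ⟩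
    sum (λ t → ⟦ E x (pos t) ⟧)                  ∎
    where
    open ≤-Reasoning
    pos : Fin L → V
    pos t = at p (suc (toℕ t))
    term : Fin L → V → ℕ
    term t u = if ⌊ pos t Fin.≟ u ⌋ then ⟦ E x u ⟧ else 0
    hit : ∀ {u} → x ~ u → ∀ t → pos t ≡ u → 1 ≤ term t u
    hit {u} x~u t pt≡u with pos t Fin.≟ u
    ... | yes _ rewrite x~u = ≤-refl
    ... | no ≢  = ⊥-elim (≢ pt≡u)
    located : ∀ {u} → x ~ u → (∃ λ t → t ≤ L × u ≡ at p t) → 1 ≤ sum (λ t → term t u)
    -- Position `0` holds `x`, which is not its own neighbour; hence `hits` may start at position
    -- `1`.
    located {u} x~u (zero , _ , u≡) = ⊥-elim (false≢true
        (trans (sym (E-irrefl x)) (subst (x ~_) (trans u≡ (source p)) x~u)))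
      where
      false≢true : false ≢ true
      false≢true ()
    located {u} x~u (suc t , t<L , u≡) = ≤-trans
      (hit x~u (fromℕ< t<L) (trans (cong (at p ∘ suc) (Fin.toℕ-fromℕ< t<L)) (sym u≡)))
      (term≤sum (λ t → term t u) (fromℕ< t<L))
    bound : ∀ u → Dec (S u ≡ true) → Dec (x ~ u) → ⟦ S u ∧ E x u ⟧ ≤ sum (λ t → term t u)
    bound u (yes Su) (yes x~u) = ≤-trans (⟦⟧≤1 (S u ∧ E x u)) (located x~u (cov u Su x~u))
    bound u (yes _)  (no x≁u)  = ≤-trans (⟦∧⟧≤ʳ (S u) (E x u)) (≤-trans (≤-reflexive (cong ⟦_⟧ (Bool.¬-not x≁u))) z≤n)
    bound u (no u∉S) _         = ≤-trans (⟦∧⟧≤ˡ (S u) (E x u)) (≤-trans (≤-reflexive (cong ⟦_⟧ (Bool.¬-not u∉S))) z≤n)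

  module _ {P : V → Set} {x y : V} {L : ℕ} (p : Path _~_ P x y L) where

    m : ℕ
    m = g ∸ 2

    nb : ℕ → Bool
    nb t = E x (at p t)

    advance : ∀ {a t c} → 1 ≤ a → nb a ≡ true → a + t ≤ L → suc c ≤ hits (λ z → nb (a + suc z)) t →
      ∃₂ λ a′ t′ → a < a′ × a + m ≤ a′ × nb a′ ≡ true × a′ + t′ ≤ L × c ≤ hits (λ z → nb (a′ + suc z)) t′
    advance {a} {t} {c} 1≤a nba a+t≤L le =
      let (s , t′ , hit , s+t′≡t , le′) = next-hit (λ z → nb (a + suc z)) t le
          a′+t′≤L = ≤-trans (≤-reflexive (trans (regroup a s t′) (cong (a +_) s+t′≡t))) a+t≤L
          a<a′    = ≤-trans (s≤s (m≤m+n a s)) (≤-reflexive (sym (+-suc a s)))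
      in a + suc s , t′ , a<a′ , gap p 1≤a a<a′ (≤-trans (m≤m+n _ t′) a′+t′≤L) nba hit , hit , a′+t′≤L ,
         ≤-trans le′ (≤-reflexive (sum-cong-≗ {t′} (λ z → cong (⟦_⟧ ∘ nb) (sym (+-assoc a (suc s) (suc (toℕ z)))))))
      where
      regroup : ∀ e f h → e + suc f + h ≡ e + (f + suc h)
      regroup = solve-∀

    -- Each of the `c` remaining neighbours lies at least `m` positions beyond the one before.
    furthest : ∀ c {a t} → 1 ≤ a → nb a ≡ true → a + t ≤ L → c ≤ hits (λ z → nb (a + suc z)) t →
      ∃ λ b → a + c * m ≤ b × b ≤ L × nb b ≡ true
    furthest zero {a} 1≤a nba a+t≤L _ = a , ≤-reflexive (+-identityʳ a) , ≤-trans (m≤m+n a _) a+t≤L , nba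
    furthest (suc c) {a} 1≤a nba a+t≤L le =
      let (a′ , t′ , a<a′ , a+m≤a′ , nba′ , a′+t′≤L , le′) = advance 1≤a nba a+t≤L le
          (b , a′+cm≤b , b≤L , nbb) = furthest c (≤-trans 1≤a (<⇒≤ a<a′)) nba′ a′+t′≤L le′
      in b , ≤-trans (≤-reflexive (sym (+-assoc a m (c * m)))) (≤-trans (+-monoˡ-≤ (c * m) a+m≤a′) a′+cm≤b) , b≤L , nbb

  long-cycle : ∀ {k} → 2 ≤ k → HasCore k → ∃ λ (C : ChordedCycle _~_) → 1 + k * (g ∸ 2) ≤ ChordedCycle.last C
  long-cycle {suc (suc k)} (s≤s (s≤s z≤n)) (S , (v , Sv) , deg) =
    let (x , y , L , p , cov) = longest S (n G) ≤-refl (trivial Sv) in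
    build p (≤-trans (deg x (source-inside p)) (neighbours-on-path S p cov))
    where
    build : ∀ {P x y L} (p : Path _~_ P x y L) → 3 + k ≤ hits (λ z → E x (at p (suc z))) L →
      ∃ λ (C : ChordedCycle _~_) → 1 + (2 + k) * (g ∸ 2) ≤ ChordedCycle.last C
    build {x = x} {L = suc L} p many =
      -- Of the `3 + k` neighbours, the first is at position `1`, the second, `a`, ends the chord,
      -- and the last of `1 + k` further ones, `b`, closes the cycle. This makes `2 + k` gaps in
      -- all.
      let x~1 = subst (_~ at p 1) (source p) (linked p (s≤s z≤n))
          (a , t , 1<a , 1+m≤a , x~a , a+t≤L , le) = advance p {1} {L} {1 + k} ≤-refl x~1 ≤-refl
            (≤-pred (≤-trans many (+-monoˡ-≤ _ (⟦⟧≤1 (E x (at p 1))))))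
          (b , a+≤b , b≤L , x~b) = furthest p (1 + k) (<⇒≤ 1<a) x~a a+t≤L le
      in record
        { last = b ; end = a ; vertex = at p
        ; 2≤end    = 1<a
        ; end<last = ≤-trans (m<m+n a (≤-trans (∸-monoˡ-≤ 2 3≤g) (m≤m+n (g ∸ 2) _))) a+≤b
        ; injective = λ i≤b j≤b → distinct p (≤-trans i≤b b≤L) (≤-trans j≤b b≤L)
        ; step     = λ i<b → linked p (<-≤-trans i<b b≤L)
        ; close    = subst (at p b ~_) (sym (source p)) (trans (E-sym _ _) x~b)
        ; chord    = subst (_~ at p a) (sym (source p)) x~a }
        , ≤-trans (+-monoˡ-≤ ((1 + k) * (g ∸ 2)) 1+m≤a) a+≤b

-- Closing two-coloured paths through the forest

⌊⌋-true : ∀ {A : Set} (d : Dec A) → ⌊ d ⌋ ≡ true → A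
⌊⌋-true (yes a) _ = a

⌊⌋-false : ∀ {A : Set} (d : Dec A) → ⌊ d ⌋ ≡ false → ¬ A
⌊⌋-false (no ¬a) _ = ¬a

⌊⌋-yes : ∀ {A : Set} (d : Dec A) → A → ⌊ d ⌋ ≡ true
⌊⌋-yes (yes _) _ = refl
⌊⌋-yes (no ¬a) a = ⊥-elim (¬a a)

⌊⌋-no : ∀ {A : Set} (d : Dec A) → ¬ A → ⌊ d ⌋ ≡ false
⌊⌋-no (yes a) ¬a = ⊥-elim (¬a a)
⌊⌋-no (no _)  _  = refl

∧-true : ∀ {a b} → a ∧ b ≡ true → a ≡ true × b ≡ true
∧-true {true} {true} _ = refl , refl

-- Descends from `m` to the first failure of `P`, which occurs at `0` at the latest.
threshold : ∀ {P : ℕ → Set} → (∀ m → Dec (P m)) → ¬ P 0 → ∀ m → P m → ∃ λ h → h < m × P (suc h) × ¬ P h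
threshold P? ¬P0 zero    P0 = ⊥-elim (¬P0 P0)
threshold {P} P? ¬P0 (suc m) Pm = cases (P? m)
  where
  cases : Dec (P m) → ∃ λ h → h < suc m × P (suc h) × ¬ P h
  cases (no ¬p) = m , ≤-refl , Pm , ¬p
  cases (yes p) = let (h , h<m , q) = threshold P? ¬P0 m p in h , m<n⇒m<1+n h<m , q

module Ancestry {G : Graph} (F : Forest G) where

  open Forest F

  V : Set
  V = Fin (n G)

  Adj-sym : ∀ {u v} → Adj G u v → Adj G v u
  Adj-sym {u} {v} a = trans (Graph.sym G v u) a

  anc : ℕ → V → V
  anc zero    v = v
  anc (suc h) v = anc h (parent v)

  anc-root : ∀ i {v} → level v ≡ i → anc i v ≡ root v
  anc-root zero    l≡ = sym (root-level l≡)
  anc-root (suc i) l≡ = trans (anc-root i (parent-level l≡)) (sym (root-adj (parent-adj l≡)))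

  -- Ascend from both ends at once: ancestors that differ at height `h` differ at all lower heights,
  -- so the two branches meet only at the top. Staying below level `suc i` keeps the path off a
  -- cycle that lies on or above that level.
  tree-path : ∀ h {i x y} → level x ≡ suc i → level y ≡ suc i → h ≤ i →
    anc h x ≢ anc h y → anc (suc h) x ≡ anc (suc h) y →
    Path (Adj G) (λ v → level v < suc i) (parent x) (parent y) (h + h)
  tree-path zero {i} {x} {y} lx ly _ _ meet = subst (λ z → Path (Adj G) _ (parent x) z 0) meet
    (trivial (≤-reflexive (cong suc (parent-level lx))))
  tree-path (suc h) {suc i} {x} {y} lx ly (s≤s h≤i) apart meet =
    subst (Path (Adj G) (λ v → level v < suc (suc i)) (parent x) (parent y)) len
      (join {P = _≡ parent x} (trivial refl) (parent-adj lx′)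
        (join {Q = _≡ parent y} {R = λ v → level v < suc i ⊎ v ≡ parent y}
          (tree-path h lx′ ly′ h≤i apart meet) (Adj-sym (parent-adj ly′)) (trivial refl)
          (λ { lv refl → 1+n≰n (≤-trans (s≤s (≤-reflexive (sym ly′))) lv) }) inj₁ inj₂)
        (λ { refl (inj₁ lv) → 1+n≰n (≤-trans (s≤s (≤-reflexive (sym lx′))) lv)
           ; refl (inj₂ eq) → apart (cong (anc h) eq) })
        (λ { refl → s≤s (≤-reflexive lx′) })
        (λ { (inj₁ lv) → m<n⇒m<1+n lv ; (inj₂ refl) → s≤s (≤-reflexive ly′) }))
    where
    lx′ : level (parent x) ≡ suc i
    lx′ = parent-level lx
    ly′ : level (parent y) ≡ suc i
    ly′ = parent-level ly
    len : suc (suc (h + h + 0)) ≡ suc h + suc h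
    len = trans (cong (2 +_) (+-identityʳ (h + h))) (cong suc (sym (+-suc h h)))

  module _ {_~_ : V → V → Set} (~⇒Adj : ∀ {u v} → u ~ v → Adj G u v) (~-sym : ∀ {u v} → u ~ v → v ~ u)
    (C : ChordedCycle _~_) where

    open ChordedCycle C

    _~′_ : ℕ → ℕ → Set
    s ~′ t = vertex s ~ vertex t

    root-const : ∀ {t} → t ≤ last → root (vertex t) ≡ root (vertex 0)
    root-const {zero}  _  = refl
    root-const {suc t} t< = trans (sym (root-adj (~⇒Adj (step t<)))) (root-const (<⇒≤ t<))

    open Chord _~′_ ~-sym last end 2≤end end<last step close chord

    -- The two facts that each edge class must supply: the first puts both ends of a bichromatic
    -- path on level `i`, the second excludes the periodic colourings that `bichromatic-path` leaves
    -- open.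
    Stays Separated : ℕ → ℕ → Set
    Stays i ℓ = ∀ {s t} → Path _~′_ Vertices s t ℓ → level (vertex s) ≡ i → level (vertex t) ≡ i
    Separated i ℓ = ∀ c → Period c ℓ → Period c 2 → ∀ {s t} → s ≤ last → t ≤ last →
      level (vertex s) ≡ i → level (vertex t) ≡ i → c s ≡ c t

    -- The height `h` is fixed before `ℓ`, so a single shift serves all lengths. It exists because
    -- `w` and `w′` differ at height `0`, while at height `i` every ancestor is the common root.
    lift-cycles : ∀ i → (∀ {t} → t ≤ last → i ≤ level (vertex t)) →
      ∀ {w w′} → w ≤ last → w′ ≤ last → w ≢ w′ → level (vertex w) ≡ i → level (vertex w′) ≡ i →
      ∃ λ h → ∀ {ℓ} → 0 < ℓ → ℓ ≤ last → Stays i ℓ → Separated i ℓ → HasCycle G (2 * suc h + ℓ)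
    lift-cycles i low {w} {w′} w≤ w′≤ w≢w′ lw lw′ =
      let (h , h<i , meet , apart) = threshold meet? differ i meet-root in h , build h h<i meet apart
      where
      Meet : ℕ → Set
      Meet h = ∀ (t : Fin (suc last)) → level (vertex (toℕ t)) ≡ i → anc h (vertex (toℕ t)) ≡ anc h (vertex w)
      meet-at? : ∀ h (t : Fin (suc last)) →
        Dec (level (vertex (toℕ t)) ≡ i → anc h (vertex (toℕ t)) ≡ anc h (vertex w))
      meet-at? h t = (level (vertex (toℕ t)) ≟ i) →-dec (anc h (vertex (toℕ t)) Fin.≟ anc h (vertex w))
      meet? : ∀ h → Dec (Meet h)
      meet? h = Fin.all? (meet-at? h)
      at-ℕ : ∀ h → Meet h → ∀ {t} → t ≤ last → level (vertex t) ≡ i → anc h (vertex t) ≡ anc h (vertex w)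
      at-ℕ h meet {t} t≤ = subst (λ z → level (vertex z) ≡ i → anc h (vertex z) ≡ anc h (vertex w))
        (Fin.toℕ-fromℕ< (s≤s t≤)) (meet (fromℕ< (s≤s t≤)))
      differ : ¬ Meet 0
      differ meet = w≢w′ (sym (injective w′≤ w≤ (at-ℕ 0 meet w′≤ lw′)))
      meet-root : Meet i
      meet-root t lt = trans (anc-root i lt) (trans (root-const (Fin.toℕ≤pred[n] t))
        (trans (sym (root-const w≤)) (sym (anc-root i lw))))
      build : ∀ h → h < i → Meet (suc h) → ¬ Meet h →
        ∀ {ℓ} → 0 < ℓ → ℓ ≤ last → Stays i ℓ → Separated i ℓ → HasCycle G (2 * suc h + ℓ)
      build h h<i meet apart {ℓ} 0<ℓ ℓ≤ stays separated =
        [ cycle , (λ pers → ⊥-elim (monochromatic pers)) ]′ (bichromatic-path c c-period ℓ 0<ℓ (s≤s ℓ≤))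
        where
        InBranch : ℕ → Set
        InBranch t = level (vertex t) ≡ i × anc h (vertex t) ≡ anc h (vertex w)
        inBranch? : ∀ t → Dec (InBranch t)
        inBranch? t = (level (vertex t) ≟ i) ×-dec (anc h (vertex t) Fin.≟ anc h (vertex w))
        c : ℕ → Bool
        c t = ⌊ inBranch? (t % suc last) ⌋
        c-period : Period c (suc last)
        c-period t = cong (λ z → ⌊ inBranch? z ⌋) ([m+n]%n≡m%n t (suc last))
        c-at : ∀ {t} → t ≤ last → c t ≡ ⌊ inBranch? t ⌋
        c-at t≤ = cong (λ z → ⌊ inBranch? z ⌋) (m<n⇒m%n≡m (s≤s t≤))
        -- By the choice of `h`, some vertex on level `i` lies outside the branch of `w`, yet it
        -- would have the colour of `w`.
        monochromatic : ¬ (Period c ℓ × Period c 2)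
        monochromatic (per , per2) =
          let (t , ¬at) = Fin.¬∀⟶∃¬ (suc last) _ (meet-at? h) apart
              t≤ = Fin.toℕ≤pred[n] t
          in ¬at λ lt → proj₂ (⌊⌋-true (inBranch? (toℕ t)) (trans (sym (c-at t≤))
               (trans (separated c per per2 t≤ w≤ lt lw) (trans (c-at w≤) (⌊⌋-yes (inBranch? w) (lw , refl))))))
        cycle : Bichromatic c c-period ℓ 0<ℓ (s≤s ℓ≤) → HasCycle G (2 * suc h + ℓ)
        cycle (x , y , p , cx , cy) = subst (HasCycle G) (regroup ℓ h) (closed-path {G}
          (join {R = λ _ → ⊤} (embed vertex (λ { (s≤s i≤) (s≤s j≤) → injective i≤ j≤ }) ~⇒Adj (λ { (s≤s t≤) → low t≤ }) p)
            (parent-adj (trans ly (sym i≡)))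
            (tree-path h (trans ly (sym i≡)) (trans lx (sym i≡)) (≤-pred (≤-trans h<i (≤-reflexive (sym i≡))))
              (λ eq → offBranch (ly , trans eq (proj₂ onBranch)))
              (trans (at-ℕ (suc h) meet y≤ ly) (sym (at-ℕ (suc h) meet x≤ lx))))
            (λ {v} i≤lv lv< → <⇒≱ (≤-trans lv< (≤-reflexive i≡)) i≤lv)
            (λ _ → tt) (λ _ → tt))
          (s≤s (≤-trans 0<ℓ (m≤m+n ℓ (h + h))))
          (Adj-sym (parent-adj (trans lx (sym i≡)))))
          where
          x≤ : x ≤ last
          x≤ = ≤-pred (source-inside p)
          y≤ : y ≤ last
          y≤ = ≤-pred (target-inside p)
          i≡ : suc (i ∸ 1) ≡ i
          i≡ = m+[n∸m]≡n (≤-trans (s≤s z≤n) h<i)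
          onBranch : InBranch x
          onBranch = ⌊⌋-true (inBranch? x) (trans (sym (c-at x≤)) cx)
          offBranch : ¬ InBranch y
          offBranch = ⌊⌋-false (inBranch? y) (trans (sym (c-at y≤)) cy)
          lx : level (vertex x) ≡ i
          lx = proj₁ onBranch
          ly : level (vertex y) ≡ i
          ly = stays p lx
          regroup : ∀ a e → suc (suc (a + (e + e))) ≡ 2 * suc e + a
          regroup = solve-∀

-- Levels along a cycle within one edge class

⌊≟⌋-sym : ∀ a b → ⌊ a ≟ b ⌋ ≡ ⌊ b ≟ a ⌋
⌊≟⌋-sym a b = cases (a ≟ b)
  where
  cases : Dec (a ≡ b) → ⌊ a ≟ b ⌋ ≡ ⌊ b ≟ a ⌋
  cases (yes a≡b) = trans (⌊⌋-yes (a ≟ b) a≡b) (sym (⌊⌋-yes (b ≟ a) (sym a≡b)))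
  cases (no a≢b)  = trans (⌊⌋-no (a ≟ b) a≢b) (sym (⌊⌋-no (b ≟ a) (a≢b ∘ sym)))

not-⌊⌋ : ∀ {A : Set} (d : Dec A) → not ⌊ d ⌋ ≡ true → ¬ A
not-⌊⌋ (no ¬a) _ = ¬a

-- The fibres of halving are the pairs `2j`, `2j + 1`.
half-injective : ∀ a b → ⌊ a /2⌋ ≡ ⌊ b /2⌋ → b ≤ suc a
half-injective a             zero          _  = z≤n
half-injective a             (suc zero)    _  = s≤s z≤n
half-injective (suc (suc a)) (suc (suc b)) eq = s≤s (s≤s (half-injective a b (suc-injective eq)))

half-suc : ∀ a → ⌊ a /2⌋ ≡ ⌊ suc a /2⌋ ⊎ ⌊ suc a /2⌋ ≡ ⌊ suc (suc a) /2⌋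
half-suc zero          = inj₁ refl
half-suc (suc zero)    = inj₂ refl
half-suc (suc (suc a)) = [ inj₁ ∘ cong suc , inj₂ ∘ cong suc ]′ (half-suc a)

-- Consecutive levels not of the form `2j`, `2j + 1` have the form `2j + 1`, `2j + 2`, and a shift
-- by one pairs them. This lets both classes of edges between levels share one argument.
adjacent-halves : ∀ {a b} → a ≢ b → a ≤ suc b → b ≤ suc a → ⌊ a /2⌋ ≢ ⌊ b /2⌋ → ⌊ suc a /2⌋ ≡ ⌊ suc b /2⌋
adjacent-halves {a} {b} a≢b a≤ b≤ halves≢ = cases (m≤n⇒m<n∨m≡n a≤) (m≤n⇒m<n∨m≡n b≤)
  where
  cases : a < suc b ⊎ a ≡ suc b → b < suc a ⊎ b ≡ suc a → ⌊ suc a /2⌋ ≡ ⌊ suc b /2⌋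
  cases (inj₂ refl) _           = [ (λ eq → ⊥-elim (halves≢ (sym eq))) , sym ]′ (half-suc b)
  cases (inj₁ _)    (inj₂ refl) = [ ⊥-elim ∘ halves≢ , id ]′ (half-suc a)
  cases (inj₁ a≤b)  (inj₁ b≤a)  = ⊥-elim (a≢b (≤-antisym (≤-pred a≤b) (≤-pred b≤a)))

1≉0-mod-2 : ¬ 1 ≈ 0 [mod 2 ]
1≉0-mod-2 (congruent u v eq) = 1+n≰n (∣⇒≤ 2∣1)
  where
  2∣1 : 2 ∣ 1
  2∣1 = ∣m+n∣m⇒∣n (divides v (trans (+-comm (u * 2) 1) eq)) (divides u refl)

alternation : ∀ (f : ℕ → ℕ) {i L} → (∀ {t} → t ≤ L → f t ≡ i ⊎ f t ≡ suc i) → (∀ {t} → t < L → f t ≢ f (suc t)) →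
  ∀ t → t ≤ L → (t ≈ 0 [mod 2 ] × f t ≡ f 0) ⊎ (t ≈ 1 [mod 2 ] × f t ≢ f 0)
alternation f two flip zero    _   = inj₁ (≡⇒≈ refl , refl)
alternation f {i} {L} two flip (suc t) t<L = [ even , odd ]′ (alternation f two flip t (<⇒≤ t<L))
  where
  1+ : ∀ {a b} → a ≈ b [mod 2 ] → suc a ≈ suc b [mod 2 ]
  1+ = +-≈ {x = 1} (≡⇒≈ refl)
  even : t ≈ 0 [mod 2 ] × f t ≡ f 0 → (suc t ≈ 0 [mod 2 ] × f (suc t) ≡ f 0) ⊎ (suc t ≈ 1 [mod 2 ] × f (suc t) ≢ f 0)
  even (t≈0 , eq) = inj₂ (1+ t≈0 , λ eq′ → flip t<L (trans eq (sym eq′)))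
  odd : t ≈ 1 [mod 2 ] × f t ≢ f 0 → (suc t ≈ 0 [mod 2 ] × f (suc t) ≡ f 0) ⊎ (suc t ≈ 1 [mod 2 ] × f (suc t) ≢ f 0)
  odd (t≈1 , neq) = inj₁ (≈-trans (1+ t≈1) (congruent 0 1 refl) , back (two (<⇒≤ t<L)) (two t<L) (two z≤n))
    where
    back : f t ≡ i ⊎ f t ≡ suc i → f (suc t) ≡ i ⊎ f (suc t) ≡ suc i → f 0 ≡ i ⊎ f 0 ≡ suc i → f (suc t) ≡ f 0
    back _        (inj₁ b) (inj₁ c) = trans b (sym c)
    back _        (inj₂ b) (inj₂ c) = trans b (sym c)
    back (inj₁ a) (inj₁ b) _        = ⊥-elim (flip t<L (trans a (sym b)))
    back (inj₂ a) (inj₂ b) _        = ⊥-elim (flip t<L (trans a (sym b)))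
    back (inj₁ a) _        (inj₁ c) = ⊥-elim (neq (trans a (sym c)))
    back (inj₂ a) _        (inj₂ c) = ⊥-elim (neq (trans a (sym c)))

module Cases {G : Graph} (F : Forest G) {_~_ : Fin (n G) → Fin (n G) → Set}
  (~⇒Adj : ∀ {u v} → u ~ v → Adj G u v) (~-sym : ∀ {u v} → u ~ v → v ~ u) (C : ChordedCycle _~_) where

  open Forest F
  open ChordedCycle C
  open Ancestry F using (_~′_; Stays; Separated; lift-cycles)

  lev : ℕ → ℕ
  lev t = level (vertex t)

  CyclesFrom : (ℕ → Set) → Set
  CyclesFrom Par = ∃ λ h → ∀ {ℓ} → 0 < ℓ → ℓ ≤ last → Par ℓ → HasCycle G (2 * suc h + ℓ)

  1≤last : 1 ≤ last
  1≤last = ≤-trans (s≤s z≤n) end<last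

  3≤last : 3 ≤ last
  3≤last = ≤-trans (s≤s 2≤end) end<last

  -- All vertices are on one level, so ends cause no trouble; an odd period together with period 2
  -- gives period 1, a constant colouring.
  same-level : (∀ {u v} → u ~ v → level u ≡ level v) → CyclesFrom Odd
  same-level flat =
    let (h , cycles) = lift-cycles ~⇒Adj ~-sym C (lev 0) (≤-reflexive ∘ sym ∘ const) {0} {1} z≤n 1≤last (λ ())
                         refl (const 1≤last)
    in h , λ 0<ℓ ℓ≤ odd → cycles 0<ℓ ℓ≤
         (λ {s} {t} p _ → const (≤-pred (target-inside p)))
         (λ c per per2 {s} {t} _ _ _ _ → period-≈ (period-1 odd per per2) {s} {t}
           (congruent t s (trans (cong (s +_) (*-identityʳ t)) (trans (+-comm s t) (cong (t +_) (sym (*-identityʳ s)))))))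
    where
    const : ∀ {t} → t ≤ last → lev t ≡ lev 0
    const {zero}  _  = refl
    const {suc t} t< = trans (sym (flat (step t<))) (const (<⇒≤ t<))
    period-1 : ∀ {c ℓ} → Odd ℓ → Period c ℓ → Period c 2 → Period c 1
    period-1 {c} {ℓ} odd per per2 x with parity ℓ
      where
      parity : ∀ m → 2 ∣ m ⊎ ∃ λ q → m ≡ 1 + q * 2
      parity zero          = inj₁ (divides 0 refl)
      parity (suc zero)    = inj₂ (0 , refl)
      parity (suc (suc m)) with parity m
      ... | inj₁ (divides q eq) = inj₁ (divides (suc q) (cong (2 +_) eq))
      ... | inj₂ (q , eq)       = inj₂ (suc q , cong (2 +_) eq)
    ... | inj₁ even = ⊥-elim (odd even)
    ... | inj₂ (q , refl) = trans (sym (period-* per2 q (x + 1))) (trans (cong c (+-assoc x 1 (q * 2))) (per x))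

  -- `key` is constant on the cycle, which is thereby confined to two consecutive levels and
  -- alternates between them. Even paths preserve the level, and positions on the lower level all
  -- have the same parity, so period 2 makes the colour constant there.
  two-levels : (key : ℕ → ℕ) → (∀ a b → key a ≡ key b → b ≤ suc a) →
    (∀ {u v} → u ~ v → key (level u) ≡ key (level v)) → (∀ {u v} → u ~ v → level u ≢ level v) → CyclesFrom Even
  -- One of the first two vertices is on the lower level, and the vertex two steps later is a second
  -- one there; `3 ≤ last` leaves room for both cases.
  two-levels key close-keys keys≡ levels≢ = [ start 0 (<⇒≤ 3≤last) , start 1 3≤last ]′ lower
    where
    key-const : ∀ {t} → t ≤ last → key (lev t) ≡ key (lev 0)
    key-const {zero}  _  = refl
    key-const {suc t} t< = trans (sym (keys≡ (step t<))) (key-const (<⇒≤ t<))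
    near : ∀ {s t} → s ≤ last → t ≤ last → lev t ≤ suc (lev s)
    near s≤ t≤ = close-keys _ _ (trans (key-const s≤) (sym (key-const t≤)))
    Bottom : ℕ → Set
    Bottom w = ∃ λ w′ → w′ ≤ last × lev w′ ≡ suc (lev w)
    lower : Bottom 0 ⊎ Bottom 1
    lower = cases (≤-total (lev 0) (lev 1))
      where
      01≢ : lev 0 ≢ lev 1
      01≢ = levels≢ (step 1≤last)
      cases : lev 0 ≤ lev 1 ⊎ lev 1 ≤ lev 0 → Bottom 0 ⊎ Bottom 1
      cases (inj₁ le) = inj₁ (1 , 1≤last , ≤-antisym (near z≤n 1≤last) (≤∧≢⇒< le 01≢))
      cases (inj₂ le) = inj₂ (0 , z≤n , ≤-antisym (near 1≤last z≤n) (≤∧≢⇒< le (01≢ ∘ sym)))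
    start : ∀ w → 2 + w ≤ last → Bottom w → CyclesFrom Even
    start w w+2≤ (w′ , w′≤ , lw′) =
      let (h , cycles) = lift-cycles ~⇒Adj ~-sym C (lev w) low w≤ w+2≤ w≢w+2 refl returns
      in h , λ 0<ℓ ℓ≤ even → cycles 0<ℓ ℓ≤ (stays even) (λ c _ per2 → separated c per2)
      where
      w≢w+2 : w ≢ 2 + w
      w≢w+2 eq = m≢1+m+n w (trans eq (cong suc (+-comm 1 w)))
      w+1≤ : 1 + w ≤ last
      w+1≤ = <⇒≤ w+2≤
      w≤ : w ≤ last
      w≤ = <⇒≤ w+1≤
      low : ∀ {t} → t ≤ last → lev w ≤ lev t
      low t≤ = ≤-pred (≤-trans (≤-reflexive (sym lw′)) (near t≤ w′≤))
      two : ∀ {t} → t ≤ last → lev t ≡ lev w ⊎ lev t ≡ suc (lev w)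
      two t≤ = cases (m≤n⇒m<n∨m≡n (low t≤))
        where
        cases : lev w < lev _ ⊎ lev w ≡ lev _ → lev _ ≡ lev w ⊎ lev _ ≡ suc (lev w)
        cases (inj₁ lt) = inj₂ (≤-antisym (near w≤ t≤) lt)
        cases (inj₂ eq) = inj₁ (sym eq)
      returns : lev (2 + w) ≡ lev w
      returns = cases (two w+1≤) (two w+2≤)
        where
        cases : lev (1 + w) ≡ lev w ⊎ lev (1 + w) ≡ suc (lev w) →
                lev (2 + w) ≡ lev w ⊎ lev (2 + w) ≡ suc (lev w) → lev (2 + w) ≡ lev w
        cases _         (inj₁ eq) = eq
        cases (inj₁ eq) _         = ⊥-elim (levels≢ (step w+1≤) (sym eq))
        cases (inj₂ eq) (inj₂ eq′) = ⊥-elim (levels≢ (step w+2≤) (trans eq (sym eq′)))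
      stays : ∀ {ℓ} → Even ℓ → Stays ~⇒Adj ~-sym C (lev w) ℓ
      stays {ℓ} even p ls = subst (λ z → lev z ≡ lev w) (target p) (cases
        (alternation (lev ∘ at p) (two ∘ ≤-pred ∘ inside p) (levels≢ ∘ linked p) ℓ ≤-refl))
        where
        cases : (ℓ ≈ 0 [mod 2 ] × lev (at p ℓ) ≡ lev (at p 0)) ⊎ (ℓ ≈ 1 [mod 2 ] × lev (at p ℓ) ≢ lev (at p 0)) →
                lev (at p ℓ) ≡ lev w
        cases (inj₁ (_ , eq))  = trans eq (trans (cong lev (source p)) ls)
        cases (inj₂ (ℓ≈1 , _)) = ⊥-elim (1≉0-mod-2 (≈-trans (≈-sym ℓ≈1) (∣⇒≈0 even)))
      separated : ∀ c → Period c 2 → ∀ {s t} → s ≤ last → t ≤ last → lev s ≡ lev w → lev t ≡ lev w → c s ≡ c t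
      separated c per2 {s} {t} s≤ t≤ ls lt = period-≈ per2 (cases
          (alternation lev two (levels≢ ∘ step) s s≤) (alternation lev two (levels≢ ∘ step) t t≤))
        where
        cases : (s ≈ 0 [mod 2 ] × lev s ≡ lev 0) ⊎ (s ≈ 1 [mod 2 ] × lev s ≢ lev 0) →
                (t ≈ 0 [mod 2 ] × lev t ≡ lev 0) ⊎ (t ≈ 1 [mod 2 ] × lev t ≢ lev 0) → s ≈ t [mod 2 ]
        cases (inj₁ (s≈ , _)) (inj₁ (t≈ , _))  = ≈-trans s≈ (≈-sym t≈)
        cases (inj₂ (s≈ , _)) (inj₂ (t≈ , _))  = ≈-trans s≈ (≈-sym t≈)
        cases (inj₁ (_ , eq)) (inj₂ (_ , neq)) = ⊥-elim (neq (trans lt (trans (sym ls) eq)))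
        cases (inj₂ (_ , neq)) (inj₁ (_ , eq)) = ⊥-elim (neq (trans ls (trans (sym lt) eq)))

-- Selecting a dense class and placing the interval

module _ (G : Graph) (k g : ℕ) (2≤k : 2 ≤ k) (3≤g : 3 ≤ g) (girth : ∀ ℓ → ℓ < g → ¬ HasCycle G ℓ)
  (F : Forest G) where

  Window : (ℕ → Set) → Set
  Window Par = ∃ λ h → ∀ {ℓ} → 0 < ℓ → ℓ ≤ 1 + k * (g ∸ 2) → Par ℓ → HasCycle G (2 * suc h + ℓ)

  open Forest F

  module EdgeClass (f : Fin (n G) → Fin (n G) → Bool) (f-sym : ∀ u v → f u v ≡ f v u) where

    E : Fin (n G) → Fin (n G) → Bool
    E u v = adj G u v ∧ f u v

    E-sym : ∀ u v → E u v ≡ E v u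
    E-sym u v = cong₂ _∧_ (Graph.sym G u v) (f-sym u v)

    E-irrefl : ∀ u → E u u ≡ false
    E-irrefl u = cong (_∧ f u u) (irrefl G u)

    E⊆Adj : ∀ {u v} → E u v ≡ true → Adj G u v
    E⊆Adj e = proj₁ (∧-true e)

    satisfies : ∀ u v → E u v ≡ true → f u v ≡ true
    satisfies u v e = proj₂ (∧-true {adj G u v} e)

    open LongCycle G g girth 3≤g E E⊆Adj E-irrefl E-sym using (_~_; long-cycle)

    ~-sym : ∀ {u v} → u ~ v → v ~ u
    ~-sym {u} {v} e = trans (E-sym v u) e

    window : ∀ {Par} → Fin (n G) →
      (∀ (C : ChordedCycle _~_) → Cases.CyclesFrom F E⊆Adj ~-sym C Par) →
      2 * k * n G ≤ ∑∑ (λ u v → ⟦ E u v ⟧) → Window Par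
    window v from dense =
      let (C , long)   = long-cycle 2≤k (Core.core E E-sym E-irrefl (≤-trans (s≤s z≤n) 2≤k) v dense)
          (h , cycles) = from C
      in h , λ 0<ℓ ℓ≤ → cycles 0<ℓ (≤-trans ℓ≤ long)

  same half : Fin (n G) → Fin (n G) → Bool
  same u v = ⌊ level u ≟ level v ⌋
  half u v = ⌊ ⌊ level u /2⌋ ≟ ⌊ level v /2⌋ ⌋

  same-sym : ∀ u v → same u v ≡ same v u
  same-sym u v = ⌊≟⌋-sym (level u) (level v)

  half-sym : ∀ u v → half u v ≡ half v u
  half-sym u v = ⌊≟⌋-sym ⌊ level u /2⌋ ⌊ level v /2⌋

  module Flat  = EdgeClass same same-sym
  module Lower = EdgeClass (λ u v → not (same u v) ∧ half u v)
                   (λ u v → cong₂ (λ a b → not a ∧ b) (same-sym u v) (half-sym u v))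
  module Upper = EdgeClass (λ u v → not (same u v) ∧ not (half u v))
                   (λ u v → cong₂ (λ a b → not a ∧ not b) (same-sym u v) (half-sym u v))

  -- A third of the average degree `6 * k` is `2 * k`, the density at which a subgraph of minimum
  -- degree above `k` is found.
  window-exists : Fin (n G) → AvgDegreeAtLeast G (6 * k) → Window Odd ⊎ Window Even
  window-exists v dense = [ inj₁ ∘ flat , inj₂ ∘ [ lower , upper ]′ ]′ (one-of-three _ _ _ (begin
    2 * k * n G + (2 * k * n G + 2 * k * n G)       ≡⟨ thrice k (n G) ⟩
    6 * k * n G                                     ≤⟨ dense ⟩
    2 * edgeCount G                                 ≡⟨ handshake G ⟩
    ∑∑ (λ u v → ⟦ adj G u v ⟧)                      ≡⟨ ∑∑-cong (λ u v → ⟦⟧-split (adj G u v) (same u v) (half u v)) ⟩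
    ∑∑ (λ u v → ⟦ Flat.E u v ⟧ + (⟦ Lower.E u v ⟧ + ⟦ Upper.E u v ⟧))
      ≡⟨ ∑∑-+ (λ u v → ⟦ Flat.E u v ⟧) (λ u v → ⟦ Lower.E u v ⟧ + ⟦ Upper.E u v ⟧) ⟩
    ∑∑ (λ u v → ⟦ Flat.E u v ⟧) + ∑∑ (λ u v → ⟦ Lower.E u v ⟧ + ⟦ Upper.E u v ⟧)
      ≡⟨ cong (∑∑ (λ u v → ⟦ Flat.E u v ⟧) +_) (∑∑-+ (λ u v → ⟦ Lower.E u v ⟧) (λ u v → ⟦ Upper.E u v ⟧)) ⟩
    ∑∑ (λ u v → ⟦ Flat.E u v ⟧) + (∑∑ (λ u v → ⟦ Lower.E u v ⟧) + ∑∑ (λ u v → ⟦ Upper.E u v ⟧)) ∎))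
    where
    open ≤-Reasoning
    thrice : ∀ a b → 2 * a * b + (2 * a * b + 2 * a * b) ≡ 6 * a * b
    thrice = solve-∀
    flat : 2 * k * n G ≤ ∑∑ (λ u v → ⟦ Flat.E u v ⟧) → Window Odd
    flat = Flat.window v (λ C → Cases.same-level F Flat.E⊆Adj Flat.~-sym C
      (λ {u} {v} e → ⌊⌋-true (level u ≟ level v) (Flat.satisfies u v e)))
    lower : 2 * k * n G ≤ ∑∑ (λ u v → ⟦ Lower.E u v ⟧) → Window Even
    lower = Lower.window v (λ C → Cases.two-levels F Lower.E⊆Adj Lower.~-sym C ⌊_/2⌋ half-injective
      (λ {u} {v} e → ⌊⌋-true (⌊ level u /2⌋ ≟ ⌊ level v /2⌋) (proj₂ (∧-true {not (same u v)} (Lower.satisfies u v e))))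
      (λ {u} {v} e → not-⌊⌋ (level u ≟ level v) (proj₁ (∧-true (Lower.satisfies u v e)))))
    upper : 2 * k * n G ≤ ∑∑ (λ u v → ⟦ Upper.E u v ⟧) → Window Even
    upper = Upper.window v (λ C → Cases.two-levels F Upper.E⊆Adj Upper.~-sym C (λ l → ⌊ suc l /2⌋)
      (λ a b eq → ≤-pred (half-injective (suc a) (suc b) eq))
      (λ {u} {v} e → adjacent-halves (levels≢ {u} {v} e)
        (level-adj (trans (Graph.sym G v u) (Upper.E⊆Adj {u} {v} e))) (level-adj (Upper.E⊆Adj {u} {v} e))
        (not-⌊⌋ (⌊ level u /2⌋ ≟ ⌊ level v /2⌋) (proj₂ (∧-true {not (same u v)} (Upper.satisfies u v e)))))
      (λ {u} {v} → levels≢ {u} {v}))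
      where
      levels≢ : ∀ {u v} → Upper.E u v ≡ true → level u ≢ level v
      levels≢ {u} {v} e = not-⌊⌋ (level u ≟ level v) (proj₁ (∧-true (Upper.satisfies u v e)))

theorem5 : (k : ℕ) → 2 ≤ k → (G : Graph) → AvgDegreeAtLeast G (6 * k) →
    (g : ℕ) → Girth G g →
    Σ ℕ λ r → Odd r × 3 ≤ r ×
    ((∀ ℓ → r ≤ ℓ → ℓ ≤ r + (g ∸ 2) * k → Even ℓ → HasCycle G ℓ)
    ⊎ (∀ ℓ → r ≤ ℓ → ℓ ≤ r + (g ∸ 2) * k → Odd ℓ → HasCycle G ℓ))
-- A successor `g` unfolds `HasCycle G g`, which yields `3 ≤ g` and, through `f zero`, a vertex of
-- `G`.
theorem5 k 2≤k G dense g@(suc _) ((3≤g , f , _) , girth) =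
  -- This `r` corresponds to `ℓ = 1` in the window. The shift `2 * suc h` is even, so parity is the
  -- same before and after it.
  [ (λ (h , cycles) → suc (2 * suc h) , odd-r h , 3≤r h , inj₂ λ ℓ r≤ ≤r+ odd →
        shifted h {Par = Odd} r≤ ≤r+ cycles (λ even → odd (subst (2 ∣_) (restore h r≤) (∣m∣n⇒∣m+n (m∣m*n (suc h)) even))))
  , (λ (h , cycles) → suc (2 * suc h) , odd-r h , 3≤r h , inj₁ λ ℓ r≤ ≤r+ even →
        shifted h {Par = Even} r≤ ≤r+ cycles (∣m+n∣m⇒∣n (subst (2 ∣_) (sym (restore h r≤)) even) (m∣m*n (suc h))))
  ]′ (window-exists G k g 2≤k 3≤g girth (BreadthFirst.forest G) (f zero) dense)
  where
  odd-r : ∀ h → Odd (suc (2 * suc h))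
  odd-r h 2∣r = 1+n≰n (∣⇒≤ (∣m+n∣m⇒∣n (subst (2 ∣_) (+-comm 1 (2 * suc h)) 2∣r) (m∣m*n (suc h))))
  3≤r : ∀ h → 3 ≤ suc (2 * suc h)
  3≤r h = s≤s (*-monoʳ-≤ 2 (s≤s z≤n))
  restore : ∀ h {ℓ} → suc (2 * suc h) ≤ ℓ → 2 * suc h + (ℓ ∸ 2 * suc h) ≡ ℓ
  restore h r≤ = m+[n∸m]≡n (<⇒≤ r≤)
  shifted : ∀ h {ℓ Par} → suc (2 * suc h) ≤ ℓ → ℓ ≤ suc (2 * suc h) + (g ∸ 2) * k →
    (∀ {ℓ} → 0 < ℓ → ℓ ≤ 1 + k * (g ∸ 2) → Par ℓ → HasCycle G (2 * suc h + ℓ)) →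
    Par (ℓ ∸ 2 * suc h) → HasCycle G ℓ
  shifted h {ℓ} r≤ ≤r+ cycles par = subst (HasCycle G) (restore h r≤) (cycles (m<n⇒0<n∸m r≤)
    (+-cancelˡ-≤ (2 * suc h) _ _ (begin
      2 * suc h + (ℓ ∸ 2 * suc h)          ≡⟨ restore h r≤ ⟩
      ℓ                                    ≤⟨ ≤r+ ⟩
      suc (2 * suc h) + (g ∸ 2) * k        ≡⟨ +-suc (2 * suc h) ((g ∸ 2) * k) ⟨
      2 * suc h + suc ((g ∸ 2) * k)        ≡⟨ cong (λ z → 2 * suc h + suc z) (*-comm (g ∸ 2) k) ⟩
      2 * suc h + (1 + k * (g ∸ 2))        ∎)) par)
    where open ≤-Reasoning
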